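{- Let $A$ be an oriented tree on $n$ vertices with $k$ leaves that is not a bi-arborescence. Then $$\operatorname{unvd}(A)\le 4n-2k-4 .$$ Consequently (for such $A$, $n$, $k$), $$4n-2k-4\le\left\lceil\frac92 n-\frac52 k-\frac92\right\rceil-1 .$$
   Context: A tournament is an orientation of a complete graph. An oriented tree is an orientation of an (undirected) tree; its leaves are its vertices of total degree $1$. An oriented graph $D$ is $m$-unavoidable if every tournament on $m$ vertices contains a copy of $D$ (as a not necessarily induced subdigraph), and $\operatorname{unvd}(D)$ denotes the least $m$ such that $D$ is $m$-unavoidable. An out-arborescence (in-arborescence) is a rooted oriented tree all of whose arcs point away from (towards) its root. A bi-arborescence is a rooted oriented tree that is the union of an in-arborescence and an out-arborescence meeting only in their common root (either of the two may consist of the root alone); an oriented tree is called a bi-arborescence if it is one for some choice of root. -}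

module Defs where

open import Data.Bool using (Bool; _∨_; T)
open import Data.Fin using (Fin)
open import Data.Fin.Subset using (Subset; _∈_; _∪_; ⊤; ∣_∣)
open import Data.List using (List; _∷_; _++_; [_]; head; last; length)
import Data.List.Membership.Propositional as List
open import Data.List.Relation.Unary.Linked using (Linked)
open import Data.List.Relation.Unary.Unique.Propositional using (Unique)
open import Data.Maybe using (just)
open import Data.Nat using (ℕ; _+_; _≤_; _≟_)
open import Data.Product using (∃; ∃-syntax; Σ-syntax; _×_; _,_)
open import Data.Vec using (tabulate)
open import Function.Definitions using (Injective)
open import Level using (0ℓ)
open import Relation.Binary using (Rel; Asymmetric)
open import Relation.Binary.Construct.Closure.Symmetric using (SymClosure)
open import Relation.Binary.PropositionalEquality using (_≡_; _≢_)
open import Relation.Nullary using (¬_; does)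

-- The notions below are stated for an arc relation on any type of vertices, so
-- that they apply both to digraphs on Fin n and to digraphs on a subset of it.
-- The underlying undirected graph is the symmetric closure of the arc relation.

module _ {V : Set} where

  record Path (_~_ : Rel V 0ℓ) (u v : V) : Set where
    field
      vertices : List V
      starts   : head vertices ≡ just u
      ends     : last vertices ≡ just v
      linked   : Linked _~_ vertices
      unique   : Unique vertices

  -- A cycle base, rest₁, …, restₗ, base with at least three distinct vertices.
  record Cycle (_~_ : Rel V 0ℓ) : Set where
    field
      base   : V
      rest   : List V
      long   : 2 ≤ length rest
      linked : Linked _~_ (base ∷ rest ++ [ base ])
      unique : Unique (base ∷ rest)

  -- Asymmetry excludes loops and pairs of opposite arcs.
  record IsTournament (_⟶_ : Rel V 0ℓ) : Set where
    field
      asymmetric : Asymmetric _⟶_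
      complete   : ∀ {u v} → u ≢ v → SymClosure _⟶_ u v

  record IsOrientedTree (_⟶_ : Rel V 0ℓ) : Set where
    field
      inhabited  : V
      asymmetric : Asymmetric _⟶_
      connected  : ∀ u v → Path (SymClosure _⟶_) u v
      acyclic    : ¬ Cycle (SymClosure _⟶_)

  -- u lies on a path of the underlying graph from r to v.
  OnPath : Rel V 0ℓ → (r u v : V) → Set
  OnPath _⟶_ r u v = Σ[ p ∈ Path (SymClosure _⟶_) r v ] u List.∈ Path.vertices p

  -- In a tree, an arc u ⟶ v points away from r when the path from r to v
  -- goes through u, and towards r when the path from r to u goes through v.

  record IsOutArborescence (_⟶_ : Rel V 0ℓ) (root : V) : Set where
    field
      isOrientedTree : IsOrientedTree _⟶_
      away           : ∀ {u v} → u ⟶ v → OnPath _⟶_ root u v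

  record IsInArborescence (_⟶_ : Rel V 0ℓ) (root : V) : Set where
    field
      isOrientedTree : IsOrientedTree _⟶_
      towards        : ∀ {u v} → u ⟶ v → OnPath _⟶_ root v u

Digraph : ℕ → Set
Digraph n = Fin n → Fin n → Bool

Arc : ∀ {n} → Digraph n → Rel (Fin n) 0ℓ
Arc D u v = T (D u v)

module _ {n : ℕ} where

  degree : Digraph n → Fin n → ℕ
  degree D v = ∣ tabulate (λ w → D v w) ∣ + ∣ tabulate (λ w → D w v) ∣

  leaves : Digraph n → Subset n
  leaves D = tabulate (λ v → does (degree D v ≟ 1))

  -- A digraph whose vertex set is a subset of Fin n.
  record Part : Set where
    field
      verts : Subset n
      arcs  : Digraph n
      ends  : ∀ {u v} → Arc arcs u v → u ∈ verts × v ∈ verts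

    Vertex : Set
    Vertex = ∃[ v ] v ∈ verts

    PartArc : Rel Vertex 0ℓ
    PartArc (u , _) (v , _) = Arc arcs u v

  record IsBiArborescenceAt (D : Digraph n) (root : Fin n) : Set where
    field
      isOrientedTree   : IsOrientedTree (Arc D)
      inPart outPart   : Part

    private
      module I = Part inPart
      module O = Part outPart

    field
      root∈in          : root ∈ I.verts
      root∈out         : root ∈ O.verts
      inArborescence   : IsInArborescence I.PartArc (root , root∈in)
      outArborescence  : IsOutArborescence O.PartArc (root , root∈out)
      meet             : ∀ {v} → v ∈ I.verts → v ∈ O.verts → v ≡ root
      vertsUnion       : I.verts ∪ O.verts ≡ ⊤
      arcsUnion        : ∀ u v → D u v ≡ I.arcs u v ∨ O.arcs u v

  IsBiArborescence : Digraph n → Set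
  IsBiArborescence D = ∃ (IsBiArborescenceAt D)

-- A not necessarily induced copy of D in T.
record Copy {n m : ℕ} (D : Digraph n) (T : Digraph m) : Set where
  field
    embed     : Fin n → Fin m
    injective : Injective _≡_ _≡_ embed
    preserves : ∀ {u v} → Arc D u v → Arc T (embed u) (embed v)

Unavoidable : ∀ {n} → Digraph n → ℕ → Set
Unavoidable D m = (T : Digraph m) → IsTournament (Arc T) → Copy D T

-- The relation unvd(D) = m.
record IsUnvd {n : ℕ} (D : Digraph n) (m : ℕ) : Set where
  field
    unavoidable : Unavoidable D m
    least       : ∀ {m′} → Unavoidable D m′ → m ≤ m′

{-# OPTIONS --safe #-}
module Submission where

-- A non-leaf of A is called inner; let h ≥ 2 be the number of inner vertices and
-- a, b the numbers of in-leaves and out-leaves, so that 4n − 2k − 4 = 2(a + b) + 4(h − 1).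
--
-- Greedy embedding along a median order shows that a rooted tree with f arcs leading
-- away from the root and g arcs leading towards it is contained in every tournament on
-- 1 + 2f + 4g vertices, and dually with f and g exchanged.  Let T be a tournament on
-- N = 4n − 2k − 4 vertices and Q the set of its q vertices of outdegree less than n.
-- Some R ⊆ Q with about q/2 + b vertices receives at least b arcs from each vertex of
-- Q ∖ R.  If T − R is large enough to contain A without its out-leaves, then these can
-- be added: first, inside R, those whose neighbour is embedded in Q, and then the
-- others, as the image of their neighbour has outdegree at least n.  Otherwise the same
-- argument is applied to the reversals of A and T.  The vertices of indegree less than
-- n, which then play the role of Q, are disjoint from Q because N ≥ 2n, and this bounds
-- the sum of the two requirements so that one of them is met.

open import Defs

-- The order N is what makes the two requirements add up. Let e = h - 1, let i and o count the inner
-- arcs leading towards and away from the root, and let p be the number of vertices of indegree less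
-- than n. Up to truncation the requirements are 2(a + i) + 4o + ⌈q/2⌉ + b and 2(b + o) + 4i + ⌈p/2⌉
-- + a. As p + q ≤ N, their sum is at most 3(a + b) + 6e + N/2 + 1, which equals 2N + 1 for N = 2(a
-- + b) + 4e, so they cannot both exceed N. The prices 2 and 4 come from halving once or twice. A
-- vertex dominates half of every interval right after it, so an arc that agrees with the order
-- costs two positions. Arcs against the order are not added one at a time: a maximal piece of e′ of
-- them, all leading towards its top vertex, is placed as a whole inside 1 + 2e′ free
-- out-neighbours, which takes an interval of 2 + 4e′ positions. Inside these out-neighbours the
-- reversed statement is applied to a tree with arcs of one kind only. The hypothesis on A enters by
-- excluding stars: it gives h ≥ 2, and hence N ≥ 2n.

module Combinatorics where

  open import Data.Bool using (Bool; true; false; T; _∨_; _∧_; not; if_then_else_)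
  open import Data.Bool.Properties using (T-∨; T-∧; T-≡; T?)
  open import Data.Empty using (⊥; ⊥-elim)
  open import Data.Fin using (Fin; zero; suc)
  import Data.Fin.Properties as Fin
  open import Data.Fin.Subset as Subset using (∣_∣)
  open import Data.Fin.Subset.Properties using (⊆-antisym; ⊆⊤; x∈p∪q⁺)
  open import Data.List using (List; []; _∷_; _++_; _∷ʳ_; length; map; take; drop; last; allFin)
  import Data.List as List
  open import Data.List.Properties using (++-assoc; length-++; ++-identityʳ; ++-conicalʳ; length-take; length-map; length-tabulate; map-++; map-cong-local)
  open import Data.List.Membership.Propositional using (_∈_; _∉_)
  open import Data.List.Membership.Propositional.Properties using (∈-++⁺ˡ; ∈-++⁺ʳ; ∈-++⁻; ∈-map⁺; ∈-map⁻; ∈-∃++; ∈-allFin)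
  open import Data.List.Relation.Binary.Permutation.Propositional as ↭ using (_↭_; ↭-sym; ↭-trans; ↭-refl; prep)
  open import Data.List.Relation.Binary.Permutation.Propositional.Properties as ↭ₚ using (shift; ∈-resp-↭; ↭-length; ++⁺ˡ; ++⁺ʳ)
  open import Data.List.Relation.Binary.Permutation.Setoid.Properties using (Unique-resp-↭)
  open import Data.List.Relation.Unary.All as All using (All; []; _∷_)
  open import Data.List.Relation.Unary.AllPairs using ([]; _∷_)
  open import Data.List.Relation.Unary.Any using (here; there)
  open import Data.List.Relation.Unary.Linked using (Linked; [-]; _∷_)
  import Data.List.Relation.Unary.Linked.Properties as Linked
  open import Data.List.Relation.Unary.Unique.Propositional using (Unique)
  import Data.List.Relation.Unary.Unique.Propositional.Properties as Unique
  open import Data.Maybe using (just)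
  open import Data.Maybe.Relation.Binary.Connected using (Connected; just)
  open import Data.Nat as ℕ using (ℕ; zero; suc; _+_; _*_; _∸_; _≤_; _<_; z≤n; s≤s; s≤s⁻¹; _≤ᵇ_; ⌈_/2⌉)
  open import Data.Nat.Properties
  open import Data.Nat.Solver using (module +-*-Solver)
  open import Data.Product using (∃; ∃₂; _×_; _,_; proj₁; proj₂)
  open import Data.Sum using (_⊎_; inj₁; inj₂; [_,_]′)
  open import Data.Unit using (⊤)
  open import Data.Vec as Vec using (Vec; []; _∷_)
  open import Data.Vec.Properties using (lookup⇒[]=; []=⇒lookup; lookup∘tabulate)
  open import Data.Vec.Properties.WithK using ([]=-irrelevant)
  open import Function using (_∘_; id; flip)
  open import Function.Bundles using (Equivalence)
  open import Level using (0ℓ)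
  open import Relation.Binary using (Rel; DecidableEquality; Asymmetric)
  open import Relation.Binary.Construct.Closure.Symmetric using (SymClosure; fwd; bwd; symmetric)
  open import Relation.Binary.PropositionalEquality using (_≡_; _≢_; refl; sym; trans; cong; cong₂; subst; subst₂; setoid; module ≡-Reasoning)
  open import Relation.Nullary using (¬_; Dec; yes; no; does; contradiction)
  open import Relation.Nullary.Decidable using (map′; _×-dec_; _⊎-dec_; _→-dec_; ¬?; decidable-stable)

  open +-*-Solver using (solve; _:+_; _:*_; _:=_; con)

  -- Counting, filtering and splitting lists.

  T-not⇒¬T : ∀ {b} → T (not b) → ¬ T b
  T-not⇒¬T {false} _ ()

  ¬T⇒T-not : ∀ {b} → ¬ T b → T (not b)
  ¬T⇒T-not {true}  ¬t = ⊥-elim (¬t _)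
  ¬T⇒T-not {false} _  = _

  bit : Bool → ℕ
  bit true  = 1
  bit false = 0

  bit-T : ∀ {b} → T b → bit b ≡ 1
  bit-T {true} _ = refl

  bit-¬T : ∀ {b} → ¬ T b → bit b ≡ 0
  bit-¬T {true}  ¬t = ⊥-elim (¬t _)
  bit-¬T {false} _  = refl

  bit≤1 : ∀ b → bit b ≤ 1
  bit≤1 true  = ≤-refl
  bit≤1 false = z≤n

  module _ {A : Set} where

    count : (A → Bool) → List A → ℕ
    count p []       = 0
    count p (x ∷ xs) = bit (p x) + count p xs

    count-++ : ∀ p xs ys → count p (xs ++ ys) ≡ count p xs + count p ys
    count-++ p []       ys = refl
    count-++ p (x ∷ xs) ys = trans (cong (bit (p x) +_) (count-++ p xs ys)) (sym (+-assoc (bit (p x)) _ _))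

    count≤length : ∀ p xs → count p xs ≤ length xs
    count≤length p []       = z≤n
    count≤length p (x ∷ xs) = +-mono-≤ (bit≤1 (p x)) (count≤length p xs)

    count-↭ : ∀ p {xs ys} → xs ↭ ys → count p xs ≡ count p ys
    count-↭ p ↭.refl         = refl
    count-↭ p (↭.prep x r)   = cong (bit (p x) +_) (count-↭ p r)
    count-↭ p (↭.swap {xs} {ys} x y r) = trans
      (solve 3 (λ a b c → a :+ (b :+ c) := b :+ (a :+ c)) refl (bit (p x)) (bit (p y)) (count p xs))
      (cong (λ c → bit (p y) + (bit (p x) + c)) (count-↭ p r))
    count-↭ p (↭.trans r s)  = trans (count-↭ p r) (count-↭ p s)

    count-none : ∀ p xs → (∀ {x} → x ∈ xs → ¬ T (p x)) → count p xs ≡ 0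
    count-none p []       _ = refl
    count-none p (x ∷ xs) n rewrite bit-¬T (n (here refl)) = count-none p xs (n ∘ there)

    count-all : ∀ p xs → (∀ {x} → x ∈ xs → T (p x)) → count p xs ≡ length xs
    count-all p []       _ = refl
    count-all p (x ∷ xs) a rewrite bit-T (a (here refl)) = cong suc (count-all p xs (a ∘ there))

    -- The union bound behind most of the counting below.
    count-⊎ : ∀ {p q r : A → Bool} xs → (∀ {x} → x ∈ xs → T (p x) → T (q x) ⊎ T (r x)) →
              count p xs ≤ count q xs + count r xs
    count-⊎ []       _ = z≤n
    count-⊎ {p} {q} {r} (x ∷ xs) f = ≤-trans (+-mono-≤ (pointwise (p x) (q x) (r x) (f (here refl))) (count-⊎ {p} {q} {r} xs (f ∘ there)))
      (≤-reflexive (solve 4 (λ a b c d → a :+ b :+ (c :+ d) := a :+ c :+ (b :+ d)) refl (bit (q x)) (bit (r x)) (count q xs) (count r xs)))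
      where
      pointwise : ∀ a b c → (T a → T b ⊎ T c) → bit a ≤ bit b + bit c
      pointwise false b c _ = z≤n
      pointwise true b c g with g _
      ... | inj₁ t = ≤-trans (≤-reflexive (sym (bit-T t))) (m≤m+n _ _)
      ... | inj₂ t = ≤-trans (≤-reflexive (sym (bit-T t))) (m≤n+m _ (bit b))

    count-mono : ∀ {p q : A → Bool} xs → (∀ {x} → x ∈ xs → T (p x) → T (q x)) → count p xs ≤ count q xs
    count-mono {p} {q} xs f = ≤-trans (count-⊎ {p} {q} {λ _ → false} xs (λ i t → inj₁ (f i t)))
      (≤-reflexive (trans (cong (count q xs +_) (count-none _ xs (λ _ ()))) (+-identityʳ _)))

    count-pos : ∀ p xs → 0 < count p xs → ∃ λ x → x ∈ xs × T (p x)
    count-pos p (x ∷ xs) 0< with p x in eq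
    ... | true  = x , here refl , subst T (sym eq) _
    ... | false = let y , i , t = count-pos p xs 0< in y , there i , t

    keep : (A → Bool) → List A → List A
    keep p []       = []
    keep p (x ∷ xs) = if p x then x ∷ keep p xs else keep p xs

    length-keep : ∀ p xs → length (keep p xs) ≡ count p xs
    length-keep p []       = refl
    length-keep p (x ∷ xs) with p x
    ... | true  = cong suc (length-keep p xs)
    ... | false = length-keep p xs

    keep-++ : ∀ p xs ys → keep p (xs ++ ys) ≡ keep p xs ++ keep p ys
    keep-++ p []       ys = refl
    keep-++ p (x ∷ xs) ys with p x
    ... | true  = cong (x ∷_) (keep-++ p xs ys)
    ... | false = keep-++ p xs ys

    ∈-keep⁻ : ∀ p xs {x} → x ∈ keep p xs → x ∈ xs × T (p x)
    ∈-keep⁻ p (y ∷ xs) i with p y in eq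
    ∈-keep⁻ p (y ∷ xs) (here refl) | true = here refl , subst T (sym eq) _
    ∈-keep⁻ p (y ∷ xs) (there i)   | true = let j , t = ∈-keep⁻ p xs i in there j , t
    ∈-keep⁻ p (y ∷ xs) i           | false = let j , t = ∈-keep⁻ p xs i in there j , t

    ∈-keep⁺ : ∀ p {xs x} → x ∈ xs → T (p x) → x ∈ keep p xs
    ∈-keep⁺ p {y ∷ xs} i t with p y in eq
    ∈-keep⁺ p (here refl) t | true = here refl
    ∈-keep⁺ p (there i)   t | true = there (∈-keep⁺ p i t)
    ∈-keep⁺ p (here refl) t | false = ⊥-elim (subst T eq t)
    ∈-keep⁺ p (there i)   t | false = ∈-keep⁺ p i t

    keep-unique : ∀ p {xs} → Unique xs → Unique (keep p xs)
    keep-unique p [] = []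
    keep-unique p {x ∷ xs} (x∉ ∷ u) with p x
    ... | true  = All.tabulate (λ i → All.lookup x∉ (proj₁ (∈-keep⁻ p xs i))) ∷ keep-unique p u
    ... | false = keep-unique p u

    unique-++⁻ʳ : ∀ xs {ys : List A} → Unique (xs ++ ys) → Unique ys
    unique-++⁻ʳ []       u       = u
    unique-++⁻ʳ (x ∷ xs) (_ ∷ u) = unique-++⁻ʳ xs u

    unique-++⁻ˡ : ∀ xs {ys : List A} → Unique (xs ++ ys) → Unique xs
    unique-++⁻ˡ []       u        = []
    unique-++⁻ˡ (x ∷ xs) (x∉ ∷ u) = All.tabulate (λ i → All.lookup x∉ (∈-++⁺ˡ i)) ∷ unique-++⁻ˡ xs u

    unique-disjoint : ∀ xs {ys : List A} → Unique (xs ++ ys) → ∀ {x} → x ∈ xs → x ∈ ys → ⊥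
    unique-disjoint (x ∷ xs) (x∉ ∷ u) (here refl) j = All.lookup x∉ (∈-++⁺ʳ xs j) refl
    unique-disjoint (x ∷ xs) (x∉ ∷ u) (there i)   j = unique-disjoint xs u i j

    unique-++⁺ : ∀ {xs ys : List A} → Unique xs → Unique ys → (∀ {x} → x ∈ xs → x ∈ ys → ⊥) → Unique (xs ++ ys)
    unique-++⁺ u v d = Unique.++⁺ u v (λ (i , j) → d i j)

    unique-↭ : ∀ {xs ys : List A} → xs ↭ ys → Unique xs → Unique ys
    unique-↭ = Unique-resp-↭ (setoid A) ∘ ↭.↭⇒↭ₛ

    module _ (_≟_ : DecidableEquality A) where

      mem : List A → A → Bool
      mem []      x = false
      mem (k ∷ K) x = does (x ≟ k) ∨ mem K x

      mem⁺ : ∀ {K x} → x ∈ K → T (mem K x)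
      mem⁺ {k ∷ K} {x} i with x ≟ k
      mem⁺ i           | yes _ = _
      mem⁺ (here refl) | no n  = ⊥-elim (n refl)
      mem⁺ (there i)   | no _  = mem⁺ i

      mem⁻ : ∀ K {x} → T (mem K x) → x ∈ K
      mem⁻ (k ∷ K) {x} t with x ≟ k
      ... | yes refl = here refl
      ... | no _     = there (mem⁻ K t)

      count-≟ : ∀ k xs → Unique xs → count (λ x → does (x ≟ k)) xs ≤ 1
      count-≟ k []       u        = z≤n
      count-≟ k (x ∷ xs) (x∉ ∷ u) with x ≟ k
      ... | no _     = count-≟ k xs u
      ... | yes refl = s≤s (≤-reflexive (count-none _ xs λ {y} i t → All.lookup x∉ i (sym (from {y} t))))
        where
        from : ∀ {y} → T (does (y ≟ k)) → y ≡ k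
        from {y} t with y ≟ k
        ... | yes e = e

      count-mem : ∀ K xs → Unique xs → count (mem K) xs ≤ length K
      count-mem []      xs u = ≤-reflexive (count-none _ xs (λ _ ()))
      count-mem (k ∷ K) xs u = ≤-trans
        (count-⊎ {p = mem (k ∷ K)} {q = λ x → does (x ≟ k)} {r = mem K} xs (λ _ → Equivalence.to T-∨))
        (+-mono-≤ (count-≟ k xs u) (count-mem K xs u))

  ++-split : ∀ {A : Set} (xs ys us vs : List A) → xs ++ ys ≡ us ++ vs →
             (∃ λ ws → vs ≡ ws ++ ys × xs ≡ us ++ ws) ⊎ (∃ λ ws → us ≡ xs ++ ws × ys ≡ ws ++ vs)
  ++-split []       ys us       vs e    = inj₂ (us , refl , e)
  ++-split (x ∷ xs) ys []       vs refl = inj₁ (x ∷ xs , refl , refl)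
  ++-split (x ∷ xs) ys (u ∷ us) vs e with ++-split xs ys us vs (cong (drop 1) e) | cong (take 1) e
  ... | inj₁ (ws , p , q) | refl = inj₁ (ws , p , cong (x ∷_) q)
  ... | inj₂ (ws , p , q) | refl = inj₂ (ws , cong (x ∷_) p , q)

  take-split : ∀ {A : Set} m (xs : List A) → m ≤ length xs → ∃₂ λ us vs → xs ≡ us ++ vs × length us ≡ m
  take-split zero    xs       _         = [] , xs , refl , refl
  take-split (suc m) (x ∷ xs) (s≤s m≤) = let us , vs , e , l = take-split m xs m≤ in x ∷ us , vs , cong (x ∷_) e , cong suc l

  -- Local median orders.

  -- Half of the median order property: each vertex dominates at least half of every
  -- interval that starts right after it.
  module Order {W : Set} (arc : W → W → Bool) where

    Half : W → List W → Set
    Half a L = ∀ us vs → L ≡ us ++ vs → length us ≤ 2 * count (arc a) us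

    data Good : List W → Set where
      []  : Good []
      _∷_ : ∀ {a L} → Half a L → Good L → Good (a ∷ L)

    good-++⁻ˡ : ∀ xs {ys} → Good (xs ++ ys) → Good xs
    good-++⁻ˡ []       g       = []
    good-++⁻ˡ (x ∷ xs) {ys} (h ∷ g) = (λ us vs e → h us (vs ++ ys) (trans (cong (_++ ys) e) (++-assoc us vs ys))) ∷ good-++⁻ˡ xs g

    good-half : ∀ xs {a ys} → Good (xs ++ a ∷ ys) → Half a ys
    good-half []       (h ∷ _) = h
    good-half (x ∷ xs) (_ ∷ g) = good-half xs g

    forward : List W → ℕ
    forward []       = 0
    forward (x ∷ xs) = count (arc x) xs + forward xs

    forward-≤ : ∀ L → forward L ≤ length L * length L
    forward-≤ []      = z≤n
    forward-≤ (x ∷ L) = ≤-trans (+-mono-≤ (count≤length (arc x) L) (forward-≤ L))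
      (≤-trans (m≤n+m _ (suc (length L))) (≤-reflexive
        (solve 1 (λ n → con 1 :+ n :+ (n :+ n :* n) := (con 1 :+ n) :* (con 1 :+ n)) refl (length L))))

    forward-insert : ∀ a xs ys → forward (xs ++ a ∷ ys) ≡
                     forward (xs ++ ys) + count (λ x → arc x a) xs + count (arc a) ys
    forward-insert a []       ys = trans (+-comm (count (arc a) ys) (forward ys)) (cong (_+ count (arc a) ys) (sym (+-identityʳ _)))
    forward-insert a (x ∷ xs) ys rewrite forward-insert a xs ys | count-++ (arc x) xs (a ∷ ys) | count-++ (arc x) xs ys =
      solve 6 (λ p q b f c d → p :+ (b :+ q) :+ (f :+ c :+ d) := p :+ q :+ f :+ (b :+ c) :+ d) refl
        (count (arc x) xs) (count (arc x) ys) (bit (arc x a)) (forward (xs ++ ys)) (count (λ x → arc x a) xs) (count (arc a) ys)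

    -- A scan with `c` out-neighbours of `a` among the `l` vertices already passed. A failure comes
    -- with the offending prefix, since `improve` has to move `a` behind it.
    half? : ∀ a c l L → (∀ us vs → L ≡ us ++ vs → l + length us ≤ 2 * (c + count (arc a) us)) ⊎
                        (∃₂ λ us vs → L ≡ us ++ vs × 2 * (c + count (arc a) us) < l + length us)
    half? a c l L with l ≤? 2 * c
    half? a c l L | no ¬p =
      inj₂ ([] , L , refl , subst₂ (λ x y → 2 * x < y) (sym (+-identityʳ c)) (sym (+-identityʳ l)) (≰⇒> ¬p))
    half? a c l [] | yes p =
      inj₁ λ { [] vs _ → subst₂ (λ x y → y ≤ 2 * x) (sym (+-identityʳ c)) (sym (+-identityʳ l)) p }
    half? a c l (x ∷ L) | yes p with half? a (c + bit (arc a x)) (suc l) L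
    ... | inj₁ f = inj₁ λ
      { [] vs _ → subst₂ (λ x y → y ≤ 2 * x) (sym (+-identityʳ c)) (sym (+-identityʳ l)) p
      ; (_ ∷ us) vs refl → subst₂ (λ x y → y ≤ 2 * x) (+-assoc c (bit (arc a x)) _) (sym (+-suc l (length us))) (f us vs refl) }
    ... | inj₂ (us , vs , e , q) = inj₂ (x ∷ us , vs , cong (x ∷_) e ,
      subst₂ (λ x y → 2 * x < y) (+-assoc c (bit (arc a x)) _) (sym (+-suc l (length us))) q)

    module _ (complete : ∀ {x y} → x ≢ y → T (arc x y) ⊎ T (arc y x)) where

      in+out : ∀ {a} xs → a ∉ xs → length xs ≤ count (λ x → arc x a) xs + count (arc a) xs
      in+out {a} xs a∉ = ≤-trans (≤-reflexive (sym (count-all (λ _ → true) xs (λ _ → _))))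
        (count-⊎ xs (λ i _ → complete (λ e → a∉ (subst (_∈ xs) e i))))

      -- The number of `forward` arcs is a potential. If `a` dominates less than half of `us`, then
      -- more arcs enter `a` from `us` than leave it towards `us`, so moving `a` behind `us` raises
      -- the potential.
      improve : ∀ L → Unique L → Good L ⊎ (∃ λ L′ → L′ ↭ L × forward L < forward L′)
      improve [] _ = inj₁ []
      improve (a ∷ L) (a∉ ∷ u) with improve L u
      ... | inj₂ (L′ , p , lt) = inj₂ (a ∷ L′ , prep a p ,
              ≤-trans (+-monoʳ-< (count (arc a) L) lt) (≤-reflexive (cong (_+ forward L′) (sym (count-↭ (arc a) p)))))
      ... | inj₁ g with half? a 0 0 L
      ... | inj₁ h = inj₁ (h ∷ g)
      ... | inj₂ (us , vs , refl , lt) = inj₂ (us ++ a ∷ vs , shift a us vs , better)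
        where
        i = count (λ x → arc x a) us
        o = count (arc a) us
        o<i : o < i
        o<i = +-cancelʳ-< o o i (≤-trans (subst (λ z → suc (o + z) ≤ length us) (+-identityʳ o) lt)
                (in+out us (λ j → All.lookup a∉ (∈-++⁺ˡ j) refl)))
        better : count (arc a) (us ++ vs) + forward (us ++ vs) < forward (us ++ a ∷ vs)
        better rewrite forward-insert a us vs | count-++ (arc a) us vs =
          ≤-trans (≤-reflexive (solve 3 (λ x y f → con 1 :+ (x :+ y :+ f) := con 1 :+ x :+ (f :+ y)) refl o (count (arc a) vs) (forward (us ++ vs))))
            (≤-trans (+-monoˡ-≤ _ o<i) (≤-reflexive (solve 3 (λ x y f → x :+ (f :+ y) := f :+ x :+ y) refl i (count (arc a) vs) (forward (us ++ vs)))))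

      -- Local search: each improvement raises `forward`, which never exceeds the square of the
      -- length, so that square is enough fuel.
      goodOrder : ∀ L → Unique L → ∃ λ L′ → L′ ↭ L × Good L′
      goodOrder L u = go (length L * length L) L ↭-refl (m≤n+m (length L * length L) (forward L))
        where
        go : ∀ fuel L′ → L′ ↭ L → length L * length L ≤ forward L′ + fuel → ∃ λ L′ → L′ ↭ L × Good L′
        go fuel L′ p b with improve L′ (unique-↭ (↭-sym p) u)
        ... | inj₁ g = L′ , p , g
        go zero L′ p b | inj₂ (L″ , q , lt) = contradiction
          (≤-trans b (≤-reflexive (+-identityʳ _)))
          (<⇒≱ (≤-trans lt (≤-trans (forward-≤ L″) (≤-reflexive (cong (λ m → m * m) (↭-length (↭-trans q p)))))))
        go (suc fuel) L′ p b | inj₂ (L″ , q , lt) = go fuel L″ (↭-trans q p)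
          (≤-trans b (≤-trans (≤-reflexive (+-suc (forward L′) fuel)) (+-monoˡ-≤ fuel lt)))

  take-∈ : ∀ {A : Set} m (xs : List A) {x} → x ∈ take m xs → x ∈ xs
  take-∈ (suc m) (y ∷ xs) (here e)  = here e
  take-∈ (suc m) (y ∷ xs) (there i) = there (take-∈ m xs i)

  take-++ : ∀ {A : Set} m (xs ys : List A) → take m (xs ++ ys) ≡ take m xs ++ take (m ∸ length xs) ys
  take-++ zero    []       ys = refl
  take-++ zero    (x ∷ xs) ys = refl
  take-++ (suc m) []       ys = refl
  take-++ (suc m) (x ∷ xs) ys = cong (x ∷_) (take-++ m xs ys)

  length-split : ∀ {A : Set} m {n} (xs : List A) → length xs ≡ m + n →
                 ∃₂ λ us vs → xs ≡ us ++ vs × length us ≡ m × length vs ≡ n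
  length-split zero    xs       e = [] , xs , refl , refl , e
  length-split (suc m) (x ∷ xs) e =
    let us , vs , p , q , r = length-split m xs (suc-injective e) in x ∷ us , vs , cong (x ∷_) p , cong suc q , r

  -- Rooted oriented trees and their components.

  -- Rooted oriented trees.  In t ↓ s and t in s the root of s becomes a child of
  -- the root of t, along an arc that leaves, respectively enters, the root of t.

  infixl 5 _↓_ _↑_

  data RT (V : Set) : Set where
    dot   : V → RT V
    _↓_ : RT V → RT V → RT V
    _↑_ : RT V → RT V → RT V

  module _ {V : Set} where

    root : RT V → V
    root (dot v)   = v
    root (t ↓ s) = root t
    root (t ↑ s) = root t

    verts : RT V → List V
    verts (dot v)   = v ∷ []
    verts (t ↓ s) = verts t ++ verts s
    verts (t ↑ s) = verts t ++ verts s

    arcs : RT V → List (V × V)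
    arcs (dot v)   = []
    arcs (t ↓ s) = (root t , root s) ∷ arcs t ++ arcs s
    arcs (t ↑ s) = (root s , root t) ∷ arcs t ++ arcs s

    outs ins : RT V → ℕ
    outs (dot v)   = 0
    outs (t ↓ s) = suc (outs t + outs s)
    outs (t ↑ s) = outs t + outs s
    ins (dot v)   = 0
    ins (t ↓ s) = ins t + ins s
    ins (t ↑ s) = suc (ins t + ins s)

    root∈ : ∀ t → root t ∈ verts t
    root∈ (dot v)   = here refl
    root∈ (t ↓ s) = ∈-++⁺ˡ (root∈ t)
    root∈ (t ↑ s) = ∈-++⁺ˡ (root∈ t)

    arc-ends : ∀ t {u v} → (u , v) ∈ arcs t → u ∈ verts t × v ∈ verts t
    arc-ends (t ↓ s) (here refl) = ∈-++⁺ˡ (root∈ t) , ∈-++⁺ʳ (verts t) (root∈ s)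
    arc-ends (t ↓ s) (there i) with ∈-++⁻ (arcs t) i
    ... | inj₁ j = let p , q = arc-ends t j in ∈-++⁺ˡ p , ∈-++⁺ˡ q
    ... | inj₂ j = let p , q = arc-ends s j in ∈-++⁺ʳ (verts t) p , ∈-++⁺ʳ (verts t) q
    arc-ends (t ↑ s) (here refl) = ∈-++⁺ʳ (verts t) (root∈ s) , ∈-++⁺ˡ (root∈ t)
    arc-ends (t ↑ s) (there i) with ∈-++⁻ (arcs t) i
    ... | inj₁ j = let p , q = arc-ends t j in ∈-++⁺ˡ p , ∈-++⁺ˡ q
    ... | inj₂ j = let p , q = arc-ends s j in ∈-++⁺ʳ (verts t) p , ∈-++⁺ʳ (verts t) q

    edges : RT V → ℕ
    edges t = outs t + ins t

    length-verts : ∀ t → length (verts t) ≡ suc (edges t)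
    length-verts (dot v)   = refl
    length-verts (t ↓ s) rewrite length-++ (verts t) {verts s} | length-verts t | length-verts s =
      cong suc (solve 4 (λ a b c d → a :+ b :+ (con 1 :+ (c :+ d)) := con 1 :+ (a :+ c) :+ (b :+ d)) refl (outs t) (ins t) (outs s) (ins s))
    length-verts (t ↑ s) rewrite length-++ (verts t) {verts s} | length-verts t | length-verts s =
      cong suc (solve 4 (λ a b c d → a :+ b :+ (con 1 :+ (c :+ d)) := a :+ c :+ (con 1 :+ (b :+ d))) refl (outs t) (ins t) (outs s) (ins s))

    swap : RT V → RT V
    swap (dot v)   = dot v
    swap (t ↓ s) = swap t ↑ swap s
    swap (t ↑ s) = swap t ↓ swap s

    root-swap : ∀ t → root (swap t) ≡ root t
    root-swap (dot v)   = refl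
    root-swap (t ↓ s) = root-swap t
    root-swap (t ↑ s) = root-swap t

    verts-swap : ∀ t → verts (swap t) ≡ verts t
    verts-swap (dot v)   = refl
    verts-swap (t ↓ s) = cong₂ _++_ (verts-swap t) (verts-swap s)
    verts-swap (t ↑ s) = cong₂ _++_ (verts-swap t) (verts-swap s)

    outs-swap : ∀ t → outs (swap t) ≡ ins t
    outs-swap (dot v)   = refl
    outs-swap (t ↓ s) = cong₂ _+_ (outs-swap t) (outs-swap s)
    outs-swap (t ↑ s) = cong suc (cong₂ _+_ (outs-swap t) (outs-swap s))

    ins-swap : ∀ t → ins (swap t) ≡ outs t
    ins-swap (dot v)   = refl
    ins-swap (t ↓ s) = cong suc (cong₂ _+_ (ins-swap t) (ins-swap s))
    ins-swap (t ↑ s) = cong₂ _+_ (ins-swap t) (ins-swap s)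

    arcs-swap : ∀ t {u v} → (u , v) ∈ arcs t → (v , u) ∈ arcs (swap t)
    arcs-swap (t ↓ s) (here refl) = here (cong₂ _,_ (sym (root-swap s)) (sym (root-swap t)))
    arcs-swap (t ↓ s) (there i) with ∈-++⁻ (arcs t) i
    ... | inj₁ j = there (∈-++⁺ˡ (arcs-swap t j))
    ... | inj₂ j = there (∈-++⁺ʳ (arcs (swap t)) (arcs-swap s j))
    arcs-swap (t ↑ s) (here refl) = here (cong₂ _,_ (sym (root-swap t)) (sym (root-swap s)))
    arcs-swap (t ↑ s) (there i) with ∈-++⁻ (arcs t) i
    ... | inj₁ j = there (∈-++⁺ˡ (arcs-swap t j))
    ... | inj₂ j = there (∈-++⁺ʳ (arcs (swap t)) (arcs-swap s j))

    -- The vertices joined to the root by a directed path ending at the root.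
    comp : RT V → RT V
    comp (dot v)   = dot v
    comp (t ↓ s) = comp t
    comp (t ↑ s) = comp t ↑ comp s

    -- In reverse order of placement: `fill` completes `t` first, then hangs `comp s`, then
    -- completes `s`, and the newest vertices come in front.
    rest : RT V → List V
    rest (dot v)   = []
    rest (t ↓ s) = rest s ++ verts (comp s) ++ rest t
    rest (t ↑ s) = rest s ++ rest t

    root-comp : ∀ t → root (comp t) ≡ root t
    root-comp (dot v)   = refl
    root-comp (t ↓ s) = root-comp t
    root-comp (t ↑ s) = root-comp t

    outs-comp : ∀ t → outs (comp t) ≡ 0
    outs-comp (dot v)   = refl
    outs-comp (t ↓ s) = outs-comp t
    outs-comp (t ↑ s) = cong₂ _+_ (outs-comp t) (outs-comp s)

    rest-comp : ∀ t → rest t ++ verts (comp t) ↭ verts t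
    rest-comp (dot v)   = ↭-refl
    rest-comp (t ↓ s) = ↭-trans (↭.↭-reflexive (trans (++-assoc (rest s) _ _) (cong (rest s ++_) (++-assoc (verts (comp s)) _ _))))
      (↭-trans (↭.↭-reflexive (sym (++-assoc (rest s) (verts (comp s)) _)))
      (↭-trans (↭ₚ.++⁺ (rest-comp s) (rest-comp t)) (↭ₚ.++-comm (verts s) (verts t))))
    rest-comp (t ↑ s) = ↭-trans (↭.↭-reflexive (++-assoc (rest s) (rest t) _))
      (↭-trans (++⁺ˡ (rest s) (↭-trans (↭.↭-reflexive (sym (++-assoc (rest t) _ _))) (++⁺ʳ _ (rest-comp t))))
      (↭-trans (↭ₚ.++-comm (rest s) _) (↭-trans (↭.↭-reflexive (++-assoc (verts t) _ _))
        (++⁺ˡ (verts t) (↭-trans (↭ₚ.++-comm (verts (comp s)) (rest s)) (rest-comp s))))))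

    -- The number of positions that `fill` consumes. Only an arc away from the root asks for new
    -- ones: 2 + 4e of them, to hang a component with e arcs.
    reach : RT V → ℕ
    reach (dot v)   = 0
    reach (t ↓ s) = reach t + (2 + 4 * edges (comp s)) + reach s
    reach (t ↑ s) = reach t + reach s

    -- Every arc towards the root lies in exactly one component and is charged 4 there; every arc
    -- away from the root hangs one component and is charged 2.
    cost : ∀ t → 4 * edges (comp t) + reach t ≡ 2 * outs t + 4 * ins t
    cost (dot v)   = refl
    cost (t ↓ s) = begin
      4 * c + (r + (2 + 4 * d) + q)           ≡⟨ solve 4 (λ c r d q → con 4 :* c :+ (r :+ (con 2 :+ con 4 :* d) :+ q) := con 4 :* c :+ r :+ (con 4 :* d :+ q) :+ con 2) refl c r d q ⟩
      4 * c + r + (4 * d + q) + 2             ≡⟨ cong (_+ 2) (cong₂ _+_ (cost t) (cost s)) ⟩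
      2 * outs t + 4 * ins t + (2 * outs s + 4 * ins s) + 2 ≡⟨ solve 4 (λ a b c d → con 2 :* a :+ con 4 :* b :+ (con 2 :* c :+ con 4 :* d) :+ con 2 := con 2 :* (con 1 :+ (a :+ c)) :+ con 4 :* (b :+ d)) refl (outs t) (ins t) (outs s) (ins s) ⟩
      2 * suc (outs t + outs s) + 4 * (ins t + ins s) ∎
      where
      open ≡-Reasoning
      c = edges (comp t) ; r = reach t ; d = edges (comp s) ; q = reach s
    cost (t ↑ s) = begin
      4 * (outs (comp t) + outs (comp s) + suc (ins (comp t) + ins (comp s))) + (r + q)
        ≡⟨ solve 6 (λ a b x y r q → con 4 :* (a :+ x :+ (con 1 :+ (b :+ y))) :+ (r :+ q) := con 4 :* (a :+ b) :+ r :+ (con 4 :* (x :+ y) :+ q) :+ con 4) refl (outs (comp t)) (ins (comp t)) (outs (comp s)) (ins (comp s)) r q ⟩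
      4 * edges (comp t) + r + (4 * edges (comp s) + q) + 4 ≡⟨ cong (_+ 4) (cong₂ _+_ (cost t) (cost s)) ⟩
      2 * outs t + 4 * ins t + (2 * outs s + 4 * ins s) + 4 ≡⟨ solve 4 (λ a b c d → con 2 :* a :+ con 4 :* b :+ (con 2 :* c :+ con 4 :* d) :+ con 4 := con 2 :* (a :+ c) :+ con 4 :* (con 1 :+ (b :+ d))) refl (outs t) (ins t) (outs s) (ins s) ⟩
      2 * (outs t + outs s) + 4 * suc (ins t + ins s) ∎
      where
      open ≡-Reasoning
      r = reach t ; q = reach s

  -- Greedy embedding along a median order.

  module Embedding {V W : Set} (_≟ⱽ_ : DecidableEquality V) (_≟_ : DecidableEquality W) where

    record Embeds (arc : W → W → Bool) (φ : V → W) (t : RT V) (L : List W) : Set where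
      field
        inside : ∀ {v} → v ∈ verts t → φ v ∈ L
        inj    : ∀ {u v} → u ∈ verts t → v ∈ verts t → φ u ≡ φ v → u ≡ v
        hom    : ∀ {u v} → (u , v) ∈ arcs t → T (arc (φ u) (φ v))

    -- Quantifying over all long enough lists allows a component to be placed inside a prescribed
    -- set of out-neighbours.
    Emb : (W → W → Bool) → ℕ → RT V → Set
    Emb arc m t = ∀ L → Unique L → m ≤ length L → ∃ λ φ → Embeds arc φ t L

    _[_↦_] : (V → W) → List V → (V → W) → V → W
    (φ [ C ↦ ψ ]) v = if mem _≟ⱽ_ C v then ψ v else φ v

    update-∈ : ∀ φ {C} ψ {v} → v ∈ C → (φ [ C ↦ ψ ]) v ≡ ψ v
    update-∈ φ {C} ψ {v} i with mem _≟ⱽ_ C v | mem⁺ _≟ⱽ_ i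
    ... | true | _ = refl

    update-∉ : ∀ φ {C} ψ {v} → v ∉ C → (φ [ C ↦ ψ ]) v ≡ φ v
    update-∉ φ {C} ψ {v} n with mem _≟ⱽ_ C v in eq
    ... | true  = contradiction (mem⁻ _≟ⱽ_ C (subst T (sym eq) _)) n
    ... | false = refl

    module Greedy (arc : W → W → Bool) where

      open Order arc

      -- The invariant that keeps later choices possible. An embedded vertex w dominates at least
      -- half of any interval right behind it, and the invariant lets used vertices occupy only
      -- about half of the old positions there, so a fresh interval must supply free out-neighbours
      -- of w.
      SufOK : List W → List W → Set
      SufOK K P = ∀ us ws → P ≡ us ++ ws → 2 * count (mem _≟_ K) ws ≤ suc (length ws)

      -- Taking the first 1 + 2e usable vertices, instead of arbitrary ones, keeps
      -- the suffixes of E sparse.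
      module Choice (K P E ys : List W) (q : W → Bool) (e : ℕ)
                    (uPE  : Unique (P ++ E))
                    (K⊆P  : ∀ {x} → x ∈ K → x ∈ P)
                    (ys⊆P : ∀ {x} → x ∈ ys → x ∈ P)
                    (uys  : Unique (ys ++ E))
                    (free : ∀ {x} → x ∈ ys ++ E → T (q x) → x ∉ K)
                    (many : ∀ E₁ zs → E ≡ E₁ ++ zs → suc (4 * e) ≤ 2 * count q (ys ++ E₁) + length zs)
                    where

        F : List W
        F = take (suc (2 * e)) (keep q (ys ++ E))

        F-unique : Unique F
        F-unique = Unique.take⁺ (suc (2 * e)) (keep-unique q uys)

        length-F : suc (2 * e) ≤ length F
        length-F = ≤-reflexive (sym (trans (length-take _ (keep q (ys ++ E))) (m≤n⇒m⊓n≡m enough)))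
          where
          c = count q (ys ++ E)
          4e<2c : suc (4 * e) ≤ 2 * c
          4e<2c = subst (suc (4 * e) ≤_) (+-identityʳ _) (many E [] (sym (++-identityʳ E)))
          enough : suc (2 * e) ≤ length (keep q (ys ++ E))
          enough = subst (suc (2 * e) ≤_) (sym (length-keep q (ys ++ E)))
            (*-cancelˡ-< 2 (2 * e) c (subst (_< 2 * c) (*-assoc 2 2 e) 4e<2c))

        F⊆ : ∀ {x} → x ∈ F → x ∈ ys ++ E × T (q x)
        F⊆ = ∈-keep⁻ q (ys ++ E) ∘ take-∈ (suc (2 * e)) _

        F⊆PE : ∀ {x} → x ∈ F → x ∈ P ++ E
        F⊆PE i with ∈-++⁻ ys (proj₁ (F⊆ i))
        ... | inj₁ j = ∈-++⁺ˡ (ys⊆P j)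
        ... | inj₂ j = ∈-++⁺ʳ P j

        F-free : ∀ {x} → x ∈ F → x ∉ K
        F-free i = let j , t = F⊆ i in free j t

        module _ (sufOK : SufOK K P)
                 {K′ : List W} (K′⊆F : ∀ {x} → x ∈ K′ → x ∈ F) (size : length K′ ≡ suc e) where

          -- No old image lies in `zs`. Among the chosen 1 + 2e vertices, those in `A` precede `zs`,
          -- so at most 1 + 2e - |A| of them can fall into `zs`, and `many` says that twice this
          -- number is at most 1 + |zs|.
          late : ∀ E₁ zs → E ≡ E₁ ++ zs → 2 * count (mem _≟_ (K′ ++ K)) zs ≤ suc (length zs)
          late E₁ zs refl = begin
            2 * count (mem _≟_ (K′ ++ K)) zs ≤⟨ *-monoʳ-≤ 2 (count-mono zs inB) ⟩
            2 * count (mem _≟_ B) zs         ≤⟨ *-monoʳ-≤ 2 (count-mem _≟_ B zs (unique-++⁻ʳ E₁ (unique-++⁻ʳ P uPE))) ⟩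
            2 * length B                     ≤⟨ *-monoʳ-≤ 2 (≤-trans (≤-reflexive (length-take n (keep q zs))) (m⊓n≤m n _)) ⟩
            2 * n                            ≡⟨ *-distribˡ-∸ 2 (suc (2 * e)) (length A) ⟩
            2 * suc (2 * e) ∸ 2 * length A   ≤⟨ m≤n+o⇒m∸n≤o (2 * suc (2 * e)) (2 * length A) bound ⟩
            suc (length zs)                  ∎
            where
            open ≤-Reasoning
            A = keep q (ys ++ E₁)
            n = suc (2 * e) ∸ length A
            B = take n (keep q zs)
            F≡ : F ≡ take (suc (2 * e)) A ++ B
            F≡ = trans (cong (take (suc (2 * e))) (trans (cong (keep q) (sym (++-assoc ys E₁ zs))) (keep-++ q (ys ++ E₁) zs)))
                       (take-++ (suc (2 * e)) A (keep q zs))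
            bound : 2 * suc (2 * e) ≤ 2 * length A + suc (length zs)
            bound = ≤-trans (≤-reflexive (solve 1 (λ e → con 2 :* (con 1 :+ con 2 :* e) := con 1 :+ (con 1 :+ con 4 :* e)) refl e))
              (≤-trans (s≤s (many E₁ zs refl)) (≤-reflexive (trans (sym (+-suc _ _)) (cong (λ l → 2 * l + suc (length zs)) (sym (length-keep q (ys ++ E₁)))))))
            z∉P : ∀ {x} → x ∈ zs → x ∉ P
            z∉P i j = unique-disjoint P uPE j (∈-++⁺ʳ E₁ i)
            inB : ∀ {x} → x ∈ zs → T (mem _≟_ (K′ ++ K) x) → T (mem _≟_ B x)
            inB {x} i t with ∈-++⁻ K′ (mem⁻ _≟_ (K′ ++ K) t)
            ... | inj₂ j = ⊥-elim (z∉P i (K⊆P j))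
            ... | inj₁ j with ∈-++⁻ (take (suc (2 * e)) A) (subst (x ∈_) F≡ (K′⊆F j))
            ... | inj₂ k = mem⁺ _≟_ k
            ... | inj₁ k with ∈-++⁻ ys (proj₁ (∈-keep⁻ q (ys ++ E₁) (take-∈ _ A k)))
            ... | inj₁ l = ⊥-elim (z∉P i (ys⊆P l))
            ... | inj₂ l = ⊥-elim (unique-disjoint E₁ (unique-++⁻ʳ P uPE) l i)

          -- Only a suffix that reaches back into `P` is new compared with `late`: the old bound
          -- covers its part in `P`, and the length of `E` pays for all e + 1 new images. The
          -- alternative `P ≡ []` serves the start of the embedding, where `E` has 1 + 4e positions,
          -- too few for 2(e + 1) when e = 0.
          extended : P ≡ [] ⊎ 2 * suc e ≤ length E → SufOK (K′ ++ K) (P ++ E)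
          extended room us zs eq with ++-split P E us zs eq | room
          ... | inj₂ (E₁ , refl , E≡) | _ = late E₁ zs E≡
          ... | inj₁ (ws , refl , P≡) | inj₁ refl rewrite ++-conicalʳ us ws (sym P≡) = late [] E refl
          ... | inj₁ (ws , refl , P≡) | inj₂ 2c≤ = begin
            2 * count (mem _≟_ (K′ ++ K)) (ws ++ E)
              ≤⟨ *-monoʳ-≤ 2 (count-⊎ {q = mem _≟_ K} {r = mem _≟_ K′} (ws ++ E) λ {x} _ t →
                   [ inj₂ ∘ mem⁺ _≟_ , inj₁ ∘ mem⁺ _≟_ ]′ (∈-++⁻ K′ (mem⁻ _≟_ (K′ ++ K) t))) ⟩
            2 * (count (mem _≟_ K) (ws ++ E) + count (mem _≟_ K′) (ws ++ E))
              ≤⟨ *-monoʳ-≤ 2 (+-mono-≤ (≤-reflexive (trans (count-++ _ ws E) (trans (cong (count (mem _≟_ K) ws +_)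
                   (count-none _ E λ i t → unique-disjoint P uPE (K⊆P (mem⁻ _≟_ K t)) i)) (+-identityʳ _))))
                   (≤-trans (count-mem _≟_ K′ _ uwE) (≤-reflexive size))) ⟩
            2 * (count (mem _≟_ K) ws + suc e) ≡⟨ *-distribˡ-+ 2 (count (mem _≟_ K) ws) (suc e) ⟩
            2 * count (mem _≟_ K) ws + 2 * suc e ≤⟨ +-mono-≤ (sufOK us ws P≡) 2c≤ ⟩
            suc (length ws) + length E         ≡⟨ cong suc (sym (length-++ ws)) ⟩
            suc (length (ws ++ E))             ∎
            where
            open ≤-Reasoning
            uwE : Unique (ws ++ E)
            uwE = unique-++⁻ʳ us (subst Unique (trans (cong (_++ E) P≡) (++-assoc us ws E)) uPE)

      record State (φ : V → W) (S : List V) (P : List W) : Set where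
        field
          inside : ∀ {v} → v ∈ S → φ v ∈ P
          inj    : ∀ {u v} → u ∈ S → v ∈ S → φ u ≡ φ v → u ≡ v
          sufOK  : SufOK (map φ S) P

      adjoin : ∀ {φ ψ S P E F} C → State φ S P → (∀ {v} → v ∈ S → v ∉ verts C) → Embeds arc ψ C F →
               (∀ {x} → x ∈ F → x ∈ P ++ E) → (∀ {x} → x ∈ F → x ∉ map φ S) →
               SufOK (map ψ (verts C) ++ map φ S) (P ++ E) → State (φ [ verts C ↦ ψ ]) (verts C ++ S) (P ++ E)
      adjoin {φ} {ψ} {S} {P} {E} C st new em F⊆ F-free ok = record
        { inside = λ i → inside′ (∈-++⁻ (verts C) i)
        ; inj    = λ i j → inj′ (∈-++⁻ (verts C) i) (∈-++⁻ (verts C) j)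
        ; sufOK  = subst (λ K → SufOK K (P ++ E)) (sym (trans (map-++ φ′ (verts C) S) (cong₂ _++_ onC onS))) ok
        }
        where
        open State st
        module C = Embeds em
        φ′ = φ [ verts C ↦ ψ ]
        onC : map φ′ (verts C) ≡ map ψ (verts C)
        onC = map-cong-local (All.tabulate (update-∈ φ ψ))
        onS : map φ′ S ≡ map φ S
        onS = map-cong-local (All.tabulate (update-∉ φ ψ ∘ new))
        inside′ : ∀ {v} → v ∈ verts C ⊎ v ∈ S → φ′ v ∈ P ++ E
        inside′ (inj₁ i) = subst (_∈ P ++ E) (sym (update-∈ φ ψ i)) (F⊆ (C.inside i))
        inside′ (inj₂ j) = subst (_∈ P ++ E) (sym (update-∉ φ ψ (new j))) (∈-++⁺ˡ (inside j))
        clash : ∀ {u v} → u ∈ verts C → v ∈ S → φ′ u ≡ φ′ v → ⊥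
        clash {u} {v} i j e = F-free (C.inside i)
          (subst (_∈ map φ S) (trans (sym (update-∉ φ ψ (new j))) (trans (sym e) (update-∈ φ ψ i))) (∈-map⁺ φ j))
        inj′ : ∀ {u v} → u ∈ verts C ⊎ u ∈ S → v ∈ verts C ⊎ v ∈ S → φ′ u ≡ φ′ v → u ≡ v
        inj′ (inj₁ i) (inj₁ j) e = C.inj i j (trans (sym (update-∈ φ ψ i)) (trans e (update-∈ φ ψ j)))
        inj′ (inj₂ i) (inj₂ j) e = inj i j (trans (sym (update-∉ φ ψ (new i))) (trans e (update-∉ φ ψ (new j))))
        inj′ (inj₁ i) (inj₂ j) e = ⊥-elim (clash i j e)
        inj′ (inj₂ i) (inj₁ j) e = ⊥-elim (clash j i (sym e))

      size-map : ∀ (ψ : V → W) C → length (map ψ (verts C)) ≡ suc (edges C)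
      size-map ψ C = trans (length-map ψ (verts C)) (length-verts C)

      map-verts⊆ : ∀ {ψ C F x} → Embeds arc ψ C F → x ∈ map ψ (verts C) → x ∈ F
      map-verts⊆ {ψ} em i with ∈-map⁻ ψ i
      ... | v , j , refl = Embeds.inside em j

      record Attached (φ : V → W) (S : List V) (P : List W) (a : V) (C : RT V) : Set where
        field
          φ′    : V → W
          state : State φ′ (verts C ++ S) P
          agree : ∀ {v} → v ∈ S → φ′ v ≡ φ v
          hom   : ∀ {u v} → (u , v) ∈ arcs C → T (arc (φ′ u) (φ′ v))
          arc⁺  : T (arc (φ′ a) (φ′ (root C)))

      -- With w the image of `a`, at least half of `ys ++ E₁` is dominated by w. The used vertices
      -- there all lie in `ys` and number at most (|ys| + 1)/2, so at least (|E₁| - 1)/2 free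
      -- out-neighbours remain. For |E| = 2 + 4e this is exactly the hypothesis `many` of `Choice`.
      attach-step : ∀ {φ S P a} E C → State φ S P → a ∈ S → (∀ {v} → v ∈ S → v ∉ verts C) →
               Emb arc (suc (2 * edges C)) C → Good (P ++ E) → Unique (P ++ E) → length E ≡ 2 + 4 * edges C →
               Attached φ S (P ++ E) a C
      attach-step {φ} {S} {P} {a} E C st a∈ new emb good uPE lenE with ∈-∃++ (State.inside st a∈)
      ... | xs , ys , P≡ = record
        { φ′    = φ [ verts C ↦ ψ ]
        ; state = adjoin C st new em F⊆PE F-free (extended (State.sufOK st) (map-verts⊆ em) (size-map ψ C) (inj₂ room))
        ; agree = update-∉ φ ψ ∘ new
        ; hom   = λ i → let p , q = arc-ends C i in
                    subst₂ (λ x y → T (arc x y)) (sym (update-∈ φ ψ p)) (sym (update-∈ φ ψ q)) (Embeds.hom em i)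
        ; arc⁺  = subst₂ (λ x y → T (arc x y)) (sym (update-∉ φ ψ (new a∈))) (sym (update-∈ φ ψ (root∈ C)))
                    (proj₁ (Equivalence.to T-∧ (proj₂ (F⊆ (Embeds.inside em (root∈ C))))))
        }
        where
        w : W
        w = φ a
        K : List W
        K = map φ S
        q : W → Bool
        q x = arc w x ∧ not (mem _≟_ K x)
        whole : P ++ E ≡ xs ++ w ∷ (ys ++ E)
        whole = trans (cong (_++ E) P≡) (++-assoc xs (w ∷ ys) E)
        K⊆P : ∀ {x} → x ∈ K → x ∈ P
        K⊆P i with ∈-map⁻ φ i
        ... | v , j , refl = State.inside st j
        unused : ∀ {x} → T (not (mem _≟_ K x)) → x ∉ K
        unused {x} t i with mem _≟_ K x | mem⁺ _≟_ i
        ... | true | _ = t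
        usable : ∀ {x} → T (arc w x) → T (q x) ⊎ T (mem _≟_ K x)
        usable {x} t with mem _≟_ K x
        ... | true  = inj₂ _
        ... | false = inj₁ (Equivalence.from T-∧ (t , _))
        uys : Unique (ys ++ E)
        uys with unique-++⁻ʳ xs (subst Unique whole uPE)
        ... | _ ∷ u = u
        half : Half w (ys ++ E)
        half = good-half xs (subst Good whole good)
        room : 2 * suc (edges C) ≤ length E
        room = ≤-trans (≤-trans (≤-reflexive (*-suc 2 (edges C))) (+-monoʳ-≤ 2 (*-monoˡ-≤ (edges C) {2} {4} (s≤s (s≤s z≤n))))) (≤-reflexive (sym lenE))
        many : ∀ E₁ zs → E ≡ E₁ ++ zs → suc (4 * edges C) ≤ 2 * count q (ys ++ E₁) + length zs
        many E₁ zs refl = s≤s⁻¹ (begin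
          2 + 4 * edges C ≡⟨ sym lenE ⟩
          length (E₁ ++ zs) ≡⟨ length-++ E₁ ⟩
          length E₁ + length zs ≤⟨ +-monoˡ-≤ (length zs) (+-cancelˡ-≤ (length ys) _ _ sparse) ⟩
          suc (2 * count q (ys ++ E₁)) + length zs ∎)
          where
          open ≤-Reasoning
          G = ys ++ E₁
          sparse : length ys + length E₁ ≤ length ys + suc (2 * count q G)
          sparse = begin
            length ys + length E₁ ≡⟨ sym (length-++ ys) ⟩
            length G ≤⟨ half G zs (sym (++-assoc ys E₁ zs)) ⟩
            2 * count (arc w) G ≤⟨ *-monoʳ-≤ 2 (count-⊎ {q = q} {r = mem _≟_ K} G (λ _ → usable)) ⟩
            2 * (count q G + count (mem _≟_ K) G) ≡⟨ *-distribˡ-+ 2 (count q G) _ ⟩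
            2 * count q G + 2 * count (mem _≟_ K) G
              ≡⟨ cong (λ c → 2 * count q G + 2 * c) (trans (count-++ _ ys E₁) (trans (cong (count (mem _≟_ K) ys +_)
                   (count-none _ E₁ λ i t → unique-disjoint P uPE (K⊆P (mem⁻ _≟_ K t)) (∈-++⁺ˡ i))) (+-identityʳ _))) ⟩
            2 * count q G + 2 * count (mem _≟_ K) ys
              ≤⟨ +-monoʳ-≤ _ (State.sufOK st (xs ++ w ∷ []) ys (trans P≡ (sym (++-assoc xs (w ∷ []) ys)))) ⟩
            2 * count q G + suc (length ys) ≡⟨ solve 2 (λ c l → c :+ (con 1 :+ l) := l :+ (con 1 :+ c)) refl (2 * count q G) (length ys) ⟩
            length ys + suc (2 * count q G) ∎
        ys⊆P : ∀ {x} → x ∈ ys → x ∈ P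
        ys⊆P i = subst (_ ∈_) (sym P≡) (∈-++⁺ʳ xs (there i))
        open Choice K P E ys q (edges C) uPE K⊆P ys⊆P uys (λ {x} _ t → unused (proj₂ (Equivalence.to (T-∧ {arc w x}) t))) many
        ψ : V → W
        ψ = proj₁ (emb F F-unique length-F)
        em : Embeds arc ψ C F
        em = proj₂ (emb F F-unique length-F)

      -- abstract: unfolding attach-step makes the type checking of fill blow up
      abstract
        attach : ∀ {φ S P a} E C → State φ S P → a ∈ S → (∀ {v} → v ∈ S → v ∉ verts C) →
                 Emb arc (suc (2 * edges C)) C → Good (P ++ E) → Unique (P ++ E) → length E ≡ 2 + 4 * edges C →
                 Attached φ S (P ++ E) a C
        attach = attach-step

      Components : RT V → Set
      Components t = Emb arc (suc (2 * edges (comp t))) (comp t)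

      -- The embeddability of components is assumed here, so that `greedy` can be used twice: once
      -- when all components are single vertices, and then for general trees with the components
      -- supplied by the reversal of the first case.
      Below : RT V → Set
      Below (dot v) = ⊤
      Below (t ↓ s) = Below t × Components s × Below s
      Below (t ↑ s) = Below t × Below s

      record Filled (φ : V → W) (S : List V) (P : List W) (t : RT V) : Set where
        field
          φ′    : V → W
          state : State φ′ (rest t ++ S) P
          agree : ∀ {v} → v ∈ S → φ′ v ≡ φ v
          hom   : ∀ {u v} → (u , v) ∈ arcs t → T (arc (φ′ u) (φ′ v))

      -- Induction on the tree with the component of the root already in place. At `t ↑ s` the
      -- component of `s` is part of it, so no position is spent on the joining arc. At `t ↓ s` the
      -- component of `s` is new and is hung below the image of `root t` by `attach`, after `t` has
      -- been completed.
      fill : ∀ {φ S P} t → Below t → State φ S P → (∀ {v} → v ∈ verts (comp t) → v ∈ S) →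
             (∀ {u v} → (u , v) ∈ arcs (comp t) → T (arc (φ u) (φ v))) → Unique (rest t ++ S) →
             ∀ E → Good (P ++ E) → Unique (P ++ E) → length E ≡ reach t → Filled φ S (P ++ E) t
      fill {φ} {P = P} (dot v) _ st _ _ _ [] _ _ _ = record
        { φ′ = φ ; state = subst (State φ _) (sym (++-identityʳ P)) st ; agree = λ _ → refl ; hom = λ () }
      fill {φ} {S} {P} (t ↑ s) (bt , bs) st c⊆ chom uS E good uPE lenE
        with length-split (reach t) E lenE
      ... | E₁ , E₂ , refl , len₁ , len₂ = record
        { φ′    = F₂.φ′
        ; state = subst₂ (State F₂.φ′) (sym (++-assoc (rest s) (rest t) S)) (++-assoc P E₁ E₂) F₂.state
        ; agree = λ i → trans (F₂.agree (∈-++⁺ʳ (rest t) i)) (F₁.agree i)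
        ; hom   = hom
        }
        where
        open ≡-Reasoning
        assoc : P ++ E₁ ++ E₂ ≡ (P ++ E₁) ++ E₂
        assoc = sym (++-assoc P E₁ E₂)
        uS′ : Unique (rest s ++ rest t ++ S)
        uS′ = subst Unique (++-assoc (rest s) (rest t) S) uS
        f₁ : Filled φ S (P ++ E₁) t
        f₁ = fill t bt st (c⊆ ∘ ∈-++⁺ˡ) (chom ∘ there ∘ ∈-++⁺ˡ) (unique-++⁻ʳ (rest s) uS′) E₁
               (good-++⁻ˡ (P ++ E₁) (subst Good assoc good)) (unique-++⁻ˡ (P ++ E₁) (subst Unique assoc uPE)) len₁
        module F₁ = Filled f₁
        keepHom : ∀ {u v} → u ∈ S → v ∈ S → T (arc (φ u) (φ v)) → T (arc (F₁.φ′ u) (F₁.φ′ v))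
        keepHom i j = subst₂ (λ x y → T (arc x y)) (sym (F₁.agree i)) (sym (F₁.agree j))
        c⊆s : ∀ {v} → v ∈ verts (comp s) → v ∈ S
        c⊆s = c⊆ ∘ ∈-++⁺ʳ (verts (comp t))
        f₂ : Filled F₁.φ′ (rest t ++ S) ((P ++ E₁) ++ E₂) s
        f₂ = fill s bs F₁.state (∈-++⁺ʳ (rest t) ∘ c⊆s)
               (λ i → let p , q = arc-ends (comp s) i in keepHom (c⊆s p) (c⊆s q) (chom (there (∈-++⁺ʳ (arcs (comp t)) i))))
               uS′ E₂ (subst Good assoc good) (subst Unique assoc uPE) len₂
        module F₂ = Filled f₂
        placed-t : ∀ {v} → v ∈ verts t → v ∈ rest t ++ S
        placed-t i with ∈-++⁻ (rest t) (∈-resp-↭ (↭-sym (rest-comp t)) i)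
        ... | inj₁ j = ∈-++⁺ˡ j
        ... | inj₂ j = ∈-++⁺ʳ (rest t) (c⊆ (∈-++⁺ˡ j))
        rootS : ∀ {v} → v ∈ S → F₂.φ′ v ≡ φ v
        rootS i = trans (F₂.agree (∈-++⁺ʳ (rest t) i)) (F₁.agree i)
        hom : ∀ {u v} → (u , v) ∈ arcs (t ↑ s) → T (arc (F₂.φ′ u) (F₂.φ′ v))
        -- The joining arc belongs to `comp (t ↑ s)`, so it was respected before anything was filled
        -- in.
        hom (here refl) = subst₂ (λ x y → T (arc x y))
          (trans (sym (rootS (c⊆s (root∈ (comp s))))) (cong F₂.φ′ (root-comp s)))
          (trans (sym (rootS (c⊆ (∈-++⁺ˡ (root∈ (comp t)))))) (cong F₂.φ′ (root-comp t)))
          (chom (here refl))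
        hom (there i) with ∈-++⁻ (arcs t) i
        ... | inj₂ j = F₂.hom j
        ... | inj₁ j = let p , q = arc-ends t j in
          subst₂ (λ x y → T (arc x y)) (sym (F₂.agree (placed-t p))) (sym (F₂.agree (placed-t q))) (F₁.hom j)
      fill {φ} {S} {P} (t ↓ s) (bt , cs , bs) st c⊆ chom uS E good uPE lenE
        with length-split (reach t) E (trans lenE (+-assoc (reach t) _ _))
      ... | E₁ , E₂₃ , refl , len₁ , len₂₃ with length-split (2 + 4 * edges (comp s)) E₂₃ len₂₃
      ... | E₂ , E₃ , refl , len₂ , len₃ = record
        { φ′    = F₃.φ′
        ; state = subst₂ (State F₃.φ′) (sym (trans (++-assoc (rest s) _ S) (cong (rest s ++_) (++-assoc (verts C) (rest t) S))))
                    (sym assoc₃) F₃.state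
        ; agree = λ i → trans (F₃.agree (∈-++⁺ʳ (verts C) (∈-++⁺ʳ (rest t) i))) (trans (F₂.agree (∈-++⁺ʳ (rest t) i)) (F₁.agree i))
        ; hom   = hom
        }
        where
        C = comp s
        assoc₁ : P ++ E₁ ++ E₂ ++ E₃ ≡ (P ++ E₁) ++ E₂ ++ E₃
        assoc₁ = sym (++-assoc P E₁ (E₂ ++ E₃))
        assoc₃ : P ++ E₁ ++ E₂ ++ E₃ ≡ ((P ++ E₁) ++ E₂) ++ E₃
        assoc₃ = trans assoc₁ (sym (++-assoc (P ++ E₁) E₂ E₃))
        good₃ = subst Good assoc₃ good
        u₃ = subst Unique assoc₃ uPE
        uS′ : Unique (rest s ++ verts C ++ rest t ++ S)
        uS′ = subst Unique (trans (++-assoc (rest s) _ S) (cong (rest s ++_) (++-assoc (verts C) (rest t) S))) uS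
        uCS : Unique (verts C ++ rest t ++ S)
        uCS = unique-++⁻ʳ (rest s) uS′
        f₁ : Filled φ S (P ++ E₁) t
        f₁ = fill t bt st c⊆ chom (unique-++⁻ʳ (verts C) uCS) E₁
               (good-++⁻ˡ (P ++ E₁) (subst Good assoc₁ good)) (unique-++⁻ˡ (P ++ E₁) (subst Unique assoc₁ uPE)) len₁
        module F₁ = Filled f₁
        placed-t : ∀ {v} → v ∈ verts t → v ∈ rest t ++ S
        placed-t i with ∈-++⁻ (rest t) (∈-resp-↭ (↭-sym (rest-comp t)) i)
        ... | inj₁ j = ∈-++⁺ˡ j
        ... | inj₂ j = ∈-++⁺ʳ (rest t) (c⊆ j)
        a₂ : Attached F₁.φ′ (rest t ++ S) ((P ++ E₁) ++ E₂) (root t) C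
        a₂ = attach E₂ C F₁.state (placed-t (root∈ t)) (λ i j → unique-disjoint (verts C) uCS j i) cs
               (good-++⁻ˡ ((P ++ E₁) ++ E₂) good₃) (unique-++⁻ˡ ((P ++ E₁) ++ E₂) u₃) len₂
        module F₂ = Attached a₂
        f₃ : Filled F₂.φ′ (verts C ++ rest t ++ S) (((P ++ E₁) ++ E₂) ++ E₃) s
        f₃ = fill s bs F₂.state ∈-++⁺ˡ F₂.hom uS′ E₃ good₃ u₃ len₃
        module F₃ = Filled f₃
        agree₃ : ∀ {v} → v ∈ rest t ++ S → F₃.φ′ v ≡ F₁.φ′ v
        agree₃ i = trans (F₃.agree (∈-++⁺ʳ (verts C) i)) (F₂.agree i)
        hom : ∀ {u v} → (u , v) ∈ arcs (t ↓ s) → T (arc (F₃.φ′ u) (F₃.φ′ v))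
        hom (here refl) = subst₂ (λ x y → T (arc x y))
          (sym (F₃.agree (∈-++⁺ʳ (verts C) (placed-t (root∈ t)))))
          (trans (sym (F₃.agree (∈-++⁺ˡ (root∈ C)))) (cong F₃.φ′ (root-comp s))) F₂.arc⁺
        hom (there i) with ∈-++⁻ (arcs t) i
        ... | inj₂ j = F₃.hom j
        ... | inj₁ j = let p , q = arc-ends t j in
          subst₂ (λ x y → T (arc x y)) (sym (agree₃ (placed-t p))) (sym (agree₃ (placed-t q))) (F₁.hom j)

      module _ (complete : ∀ {x y} → x ≢ y → T (arc x y) ⊎ T (arc y x)) where

        -- The component of the root, with e arcs, receives the first 1 + 4e positions: it is
        -- embedded in the first 1 + 2e of them, and the 2e left empty behind these establish
        -- `SufOK`. The remaining vertices take `reach t` positions, and `cost` gives the total.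
        greedy : ∀ t → Unique (verts t) → Components t → Below t → Emb arc (suc (2 * outs t + 4 * ins t)) t
        greedy t ut ct bt L uL m≤ with goodOrder complete L uL
        ... | L′ , perm , good with take-split (suc (4 * edges (comp t))) L′ (≤-trans (≤-trans (s≤s (≤-trans (m≤m+n _ (reach t)) (≤-reflexive (cost t)))) m≤) (≤-reflexive (sym (↭-length perm))))
        ... | E₁ , R , refl , len₁ with take-split (reach t) R (+-cancelˡ-≤ (suc (4 * edges (comp t))) _ _
                (≤-trans (≤-trans (s≤s (≤-reflexive (cost t))) m≤) (≤-reflexive (trans (sym (↭-length perm)) (trans (length-++ E₁) (cong (_+ length R) len₁))))))
        ... | E₂ , R′ , refl , len₂ = F₂.φ′ , record
          { inside = λ i → ∈-resp-↭ perm (widen (inside (placed i)))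
          ; inj    = λ i j → inj (placed i) (placed j)
          ; hom    = F₂.hom
          }
          where
          C = comp t
          u : Unique (E₁ ++ E₂ ++ R′)
          u = unique-↭ (↭-sym perm) uL
          u₁₂ : Unique (E₁ ++ E₂)
          u₁₂ = unique-++⁻ˡ (E₁ ++ E₂) (subst Unique (sym (++-assoc E₁ E₂ R′)) u)
          many : ∀ G zs → E₁ ≡ G ++ zs → suc (4 * edges C) ≤ 2 * count (λ _ → true) G + length zs
          many G zs e = ≤-trans (≤-reflexive (trans (sym len₁) (trans (cong length e) (length-++ G))))
            (+-monoˡ-≤ (length zs) (≤-trans (≤-reflexive (sym (count-all _ G (λ _ → _)))) (m≤m+n _ _)))
          open Choice [] [] E₁ [] (λ _ → true) (edges C) (unique-++⁻ˡ E₁ u) (λ ()) (λ ()) (unique-++⁻ˡ E₁ u) (λ _ _ ()) many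
          ψ = proj₁ (ct F F-unique length-F)
          em : Embeds arc ψ C F
          em = proj₂ (ct F F-unique length-F)
          empty : SufOK [] []
          empty [] [] _ = z≤n
          st : State ψ (verts C) E₁
          st = record
            { inside = F⊆PE ∘ Embeds.inside em
            ; inj    = Embeds.inj em
            ; sufOK  = subst (λ K → SufOK K E₁) (++-identityʳ (map ψ (verts C))) (extended empty {map ψ (verts C)} (map-verts⊆ em) (size-map ψ C) (inj₁ refl))
            }
          f₂ : Filled ψ (verts C) (E₁ ++ E₂) t
          f₂ = fill t bt st id (Embeds.hom em) (unique-↭ (↭-sym (rest-comp t)) ut) E₂
                 (good-++⁻ˡ (E₁ ++ E₂) (subst Good (sym (++-assoc E₁ E₂ R′)) good)) u₁₂ len₂
          module F₂ = Filled f₂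
          open State F₂.state
          placed : ∀ {v} → v ∈ verts t → v ∈ rest t ++ verts C
          placed = ∈-resp-↭ (↭-sym (rest-comp t))
          widen : ∀ {x} → x ∈ E₁ ++ E₂ → x ∈ E₁ ++ E₂ ++ R′
          widen i = subst (_ ∈_) (++-assoc E₁ E₂ R′) (∈-++⁺ˡ i)

    flip-embeds : ∀ {arc φ t L} → Embeds (flip arc) φ (swap t) L → Embeds arc φ t L
    flip-embeds {t = t} em = record
      { inside = inside ∘ subst (_ ∈_) (sym (verts-swap t))
      ; inj    = λ i j → inj (subst (_ ∈_) (sym (verts-swap t)) i) (subst (_ ∈_) (sym (verts-swap t)) j)
      ; hom    = hom ∘ arcs-swap t
      }
      where open Embeds em

    module _ {arc : W → W → Bool} where
      open Greedy arc

      -- Without arcs towards the root every component is a single vertex.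
      below-pure : ∀ t → ins t ≡ 0 → Components t × Below t
      below-pure (dot v) _ = single , _
        where
        single : Components (dot v)
        single (x ∷ L) _ _ = (λ _ → x) , record { inside = λ _ → here refl ; inj = λ { (here refl) (here refl) _ → refl } ; hom = λ () }
      below-pure (t ↓ s) e = proj₁ bt , proj₂ bt , bs
        where
        bt = below-pure t (m+n≡0⇒m≡0 (ins t) e)
        bs = below-pure s (m+n≡0⇒n≡0 (ins t) e)

    module _ {arc : W → W → Bool} (complete : ∀ {x y} → x ≢ y → T (arc x y) ⊎ T (arc y x)) where
      open Greedy arc

      -- All arcs of `comp t` lead towards its root. After reversing tree and tournament they lead
      -- away from it, and the pure case of `greedy` charges only 2 for each.
      component : ∀ t → Unique (verts (comp t)) → Components t
      component t u L uL m≤ = let φ , em = Greedy.greedy (flip arc) complete⁻ C⁻ (subst Unique (sym (verts-swap (comp t))) u)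
                                              (proj₁ (below-pure C⁻ pure)) (proj₂ (below-pure C⁻ pure)) L uL
                                              (≤-trans (s≤s (≤-reflexive size)) m≤)
                              in φ , flip-embeds em
        where
        C⁻ = swap (comp t)
        complete⁻ : ∀ {x y} → x ≢ y → T (arc y x) ⊎ T (arc x y)
        complete⁻ n = complete (n ∘ sym)
        pure : ins C⁻ ≡ 0
        pure = trans (ins-swap (comp t)) (outs-comp t)
        size : 2 * outs C⁻ + 4 * ins C⁻ ≡ 2 * edges (comp t)
        size rewrite pure | outs-swap (comp t) | outs-comp t = +-identityʳ _

      components : ∀ t → Unique (verts t) → Components t × Below t
      components t u = component t (unique-++⁻ʳ (rest t) (unique-↭ (↭-sym (rest-comp t)) u)) , below t u
        where
        below : ∀ t → Unique (verts t) → Below t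
        below (dot v) _ = _
        below (t ↓ s) u = below t (unique-++⁻ˡ (verts t) u) ,
          component s (unique-++⁻ʳ (rest s) (unique-↭ (↭-sym (rest-comp s)) (unique-++⁻ʳ (verts t) u))) , below s (unique-++⁻ʳ (verts t) u)
        below (t ↑ s) u = below t (unique-++⁻ˡ (verts t) u) , below s (unique-++⁻ʳ (verts t) u)

      embed-forward : ∀ t → Unique (verts t) → Emb arc (suc (2 * outs t + 4 * ins t)) t
      embed-forward t u = greedy complete t u (proj₁ (components t u)) (proj₂ (components t u))

    embed-backward : ∀ {arc : W → W → Bool} → (∀ {x y} → x ≢ y → T (arc x y) ⊎ T (arc y x)) →
                     ∀ t → Unique (verts t) → Emb arc (suc (2 * ins t + 4 * outs t)) t
    embed-backward complete t u L uL m≤ =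
      let φ , em = embed-forward (λ n → complete (n ∘ sym)) (swap t) (subst Unique (sym (verts-swap t)) u) L uL
                     (≤-trans (s≤s (≤-reflexive (cong₂ (λ x y → 2 * x + 4 * y) (outs-swap t) (ins-swap t)))) m≤)
      in φ , flip-embeds em

  -- Halves rounded up, and grafting leaves onto rooted trees.

  ≤2*⌈/2⌉ : ∀ q → q ≤ 2 * ⌈ q /2⌉
  ≤2*⌈/2⌉ 0             = z≤n
  ≤2*⌈/2⌉ 1             = s≤s z≤n
  ≤2*⌈/2⌉ (suc (suc q)) = ≤-trans (s≤s (s≤s (≤2*⌈/2⌉ q))) (≤-reflexive (sym (*-suc 2 ⌈ q /2⌉)))

  2*⌈/2⌉≤ : ∀ q → 2 * ⌈ q /2⌉ ≤ suc q
  2*⌈/2⌉≤ 0             = z≤n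
  2*⌈/2⌉≤ 1             = ≤-refl
  2*⌈/2⌉≤ (suc (suc q)) = ≤-trans (≤-reflexive (*-suc 2 ⌈ q /2⌉)) (s≤s (s≤s (2*⌈/2⌉≤ q)))

  module Graft {V : Set} (_≟_ : DecidableEquality V) where

    joinLeaf : Bool → RT V → V → RT V
    joinLeaf true  t y = t ↓ dot y
    joinLeaf false t y = t ↑ dot y

    -- Adds y as a child of z; the arc leaves z in the case true and enters it otherwise.
    graft : Bool → V → V → RT V → RT V
    graft d y z (dot v) = joinLeaf d (dot v) y
    graft d y z (t ↓ s) = if mem _≟_ (verts t) z then graft d y z t ↓ s else t ↓ graft d y z s
    graft d y z (t ↑ s) = if mem _≟_ (verts t) z then graft d y z t ↑ s else t ↑ graft d y z s

    root-graft : ∀ d y z t → root (graft d y z t) ≡ root t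
    root-graft true  y z (dot v) = refl
    root-graft false y z (dot v) = refl
    root-graft d y z (t ↓ s) with mem _≟_ (verts t) z
    ... | true  = root-graft d y z t
    ... | false = refl
    root-graft d y z (t ↑ s) with mem _≟_ (verts t) z
    ... | true  = root-graft d y z t
    ... | false = refl

    verts-graft : ∀ d y z t → verts (graft d y z t) ↭ y ∷ verts t
    verts-graft true  y z (dot v) = ↭.swap v y ↭-refl
    verts-graft false y z (dot v) = ↭.swap v y ↭-refl
    verts-graft d y z (t ↓ s) with mem _≟_ (verts t) z
    ... | true  = ++⁺ʳ (verts s) (verts-graft d y z t)
    ... | false = ↭-trans (++⁺ˡ (verts t) (verts-graft d y z s)) (shift y (verts t) (verts s))
    verts-graft d y z (t ↑ s) with mem _≟_ (verts t) z
    ... | true  = ++⁺ʳ (verts s) (verts-graft d y z t)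
    ... | false = ↭-trans (++⁺ˡ (verts t) (verts-graft d y z s)) (shift y (verts t) (verts s))

    outs-graft : ∀ d y z t → outs (graft d y z t) ≡ bit d + outs t
    outs-graft true  y z (dot v) = refl
    outs-graft false y z (dot v) = refl
    outs-graft d y z (t ↓ s) with mem _≟_ (verts t) z
    ... | true  rewrite outs-graft d y z t = solve 3 (λ b x y → con 1 :+ (b :+ x :+ y) := b :+ (con 1 :+ (x :+ y))) refl (bit d) (outs t) (outs s)
    ... | false rewrite outs-graft d y z s = solve 3 (λ b x y → con 1 :+ (x :+ (b :+ y)) := b :+ (con 1 :+ (x :+ y))) refl (bit d) (outs t) (outs s)
    outs-graft d y z (t ↑ s) with mem _≟_ (verts t) z
    ... | true  rewrite outs-graft d y z t = +-assoc (bit d) _ _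
    ... | false rewrite outs-graft d y z s = solve 3 (λ b x y → x :+ (b :+ y) := b :+ (x :+ y)) refl (bit d) (outs t) (outs s)

    ins-graft : ∀ d y z t → ins (graft d y z t) ≡ bit (not d) + ins t
    ins-graft true  y z (dot v) = refl
    ins-graft false y z (dot v) = refl
    ins-graft d y z (t ↑ s) with mem _≟_ (verts t) z
    ... | true  rewrite ins-graft d y z t = solve 3 (λ b x y → con 1 :+ (b :+ x :+ y) := b :+ (con 1 :+ (x :+ y))) refl (bit (not d)) (ins t) (ins s)
    ... | false rewrite ins-graft d y z s = solve 3 (λ b x y → con 1 :+ (x :+ (b :+ y)) := b :+ (con 1 :+ (x :+ y))) refl (bit (not d)) (ins t) (ins s)
    ins-graft d y z (t ↓ s) with mem _≟_ (verts t) z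
    ... | true  rewrite ins-graft d y z t = +-assoc (bit (not d)) _ _
    ... | false rewrite ins-graft d y z s = solve 3 (λ b x y → x :+ (b :+ y) := b :+ (x :+ y)) refl (bit (not d)) (ins t) (ins s)

    arcs-graft : ∀ d y z t {e} → e ∈ arcs t → e ∈ arcs (graft d y z t)
    arcs-graft d y z (t ↓ s) i with mem _≟_ (verts t) z
    arcs-graft d y z (t ↓ s) (here refl) | true = here (cong (_, root s) (sym (root-graft d y z t)))
    arcs-graft d y z (t ↓ s) (there i)   | true with ∈-++⁻ (arcs t) i
    ... | inj₁ j = there (∈-++⁺ˡ (arcs-graft d y z t j))
    ... | inj₂ j = there (∈-++⁺ʳ (arcs (graft d y z t)) j)
    arcs-graft d y z (t ↓ s) (here refl) | false = here (cong (root t ,_) (sym (root-graft d y z s)))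
    arcs-graft d y z (t ↓ s) (there i)   | false with ∈-++⁻ (arcs t) i
    ... | inj₁ j = there (∈-++⁺ˡ j)
    ... | inj₂ j = there (∈-++⁺ʳ (arcs t) (arcs-graft d y z s j))
    arcs-graft d y z (t ↑ s) i with mem _≟_ (verts t) z
    arcs-graft d y z (t ↑ s) (here refl) | true = here (cong (root s ,_) (sym (root-graft d y z t)))
    arcs-graft d y z (t ↑ s) (there i)   | true with ∈-++⁻ (arcs t) i
    ... | inj₁ j = there (∈-++⁺ˡ (arcs-graft d y z t j))
    ... | inj₂ j = there (∈-++⁺ʳ (arcs (graft d y z t)) j)
    arcs-graft d y z (t ↑ s) (here refl) | false = here (cong (_, root t) (sym (root-graft d y z s)))
    arcs-graft d y z (t ↑ s) (there i)   | false with ∈-++⁻ (arcs t) i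
    ... | inj₁ j = there (∈-++⁺ˡ j)
    ... | inj₂ j = there (∈-++⁺ʳ (arcs t) (arcs-graft d y z s j))

    leafArc : Bool → V → V → V × V
    leafArc true  y z = z , y
    leafArc false y z = y , z

    -- `graft` does not compare the vertex of a final `dot` with z. It descends by membership of z,
    -- so when z occurs in the tree, the `dot` it ends in is z.
    arc-graft : ∀ d y z t → z ∈ verts t → leafArc d y z ∈ arcs (graft d y z t)
    arc-graft true  y z (dot v) (here refl) = here refl
    arc-graft false y z (dot v) (here refl) = here refl
    arc-graft d y z (t ↓ s) i with mem _≟_ (verts t) z in eq
    ... | true  = there (∈-++⁺ˡ (arc-graft d y z t (mem⁻ _≟_ (verts t) (subst T (sym eq) _))))
    ... | false with ∈-++⁻ (verts t) i
    ... | inj₁ j = ⊥-elim (subst T eq (mem⁺ _≟_ j))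
    ... | inj₂ j = there (∈-++⁺ʳ (arcs t) (arc-graft d y z s j))
    arc-graft d y z (t ↑ s) i with mem _≟_ (verts t) z in eq
    ... | true  = there (∈-++⁺ˡ (arc-graft d y z t (mem⁻ _≟_ (verts t) (subst T (sym eq) _))))
    ... | false with ∈-++⁻ (verts t) i
    ... | inj₁ j = ⊥-elim (subst T eq (mem⁺ _≟_ j))
    ... | inj₂ j = there (∈-++⁺ʳ (arcs t) (arc-graft d y z s j))

    graftIns : List (V × V) → RT V → RT V
    graftIns []             t = t
    graftIns ((y , z) ∷ ls) t = graft false y z (graftIns ls t)

    verts-graftIns : ∀ ls t → verts (graftIns ls t) ↭ map proj₁ ls ++ verts t
    verts-graftIns []             t = ↭-refl
    verts-graftIns ((y , z) ∷ ls) t = ↭-trans (verts-graft false y z (graftIns ls t)) (prep y (verts-graftIns ls t))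

    outs-graftIns : ∀ ls t → outs (graftIns ls t) ≡ outs t
    outs-graftIns []             t = refl
    outs-graftIns ((y , z) ∷ ls) t = trans (outs-graft false y z (graftIns ls t)) (outs-graftIns ls t)

    ins-graftIns : ∀ ls t → ins (graftIns ls t) ≡ length ls + ins t
    ins-graftIns []             t = refl
    ins-graftIns ((y , z) ∷ ls) t = trans (ins-graft false y z (graftIns ls t)) (cong suc (ins-graftIns ls t))

    arcs-graftIns : ∀ ls t {e} → e ∈ arcs t → e ∈ arcs (graftIns ls t)
    arcs-graftIns []             t i = i
    arcs-graftIns ((y , z) ∷ ls) t i = arcs-graft false y z (graftIns ls t) (arcs-graftIns ls t i)

    leaf-graftIns : ∀ ls t → (∀ {y z} → (y , z) ∈ ls → z ∈ verts t) → ∀ {y z} → (y , z) ∈ ls → (y , z) ∈ arcs (graftIns ls t)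
    leaf-graftIns ((y , z) ∷ ls) t p (here refl) =
      arc-graft false y z (graftIns ls t) (∈-resp-↭ (↭-sym (verts-graftIns ls t)) (∈-++⁺ʳ (map proj₁ ls) (p (here refl))))
    leaf-graftIns ((y , z) ∷ ls) t p (there i)   = arcs-graft false y z (graftIns ls t) (leaf-graftIns ls t (p ∘ there) i)

  -- Dissected trees, adding leaves, and sink sets.

  -- An oriented tree split into its inner vertices, forming a rooted tree, and its
  -- leaves, each paired with its neighbour.
  record Dissection {V : Set} (D : V → V → Bool) : Set where
    field
      inner     : RT V
      inLeaves  : List (V × V)
      outLeaves : List (V × V)
      unique    : Unique (verts inner ++ map proj₁ inLeaves ++ map proj₁ outLeaves)
      covers    : ∀ v → v ∈ verts inner ++ map proj₁ inLeaves ++ map proj₁ outLeaves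
      inParent  : ∀ {y z} → (y , z) ∈ inLeaves → z ∈ verts inner
      outParent : ∀ {y z} → (y , z) ∈ outLeaves → z ∈ verts inner
      classify  : ∀ {u v} → T (D u v) → (u , v) ∈ arcs inner ⊎ (u , v) ∈ inLeaves ⊎ (v , u) ∈ outLeaves

    order : ℕ
    order = length (verts inner) + (length inLeaves + length outLeaves)

  reverse : ∀ {V : Set} {D : V → V → Bool} → Dissection D → Dissection (flip D)
  reverse δ = record
    { inner     = swap inner
    ; inLeaves  = outLeaves
    ; outLeaves = inLeaves
    ; unique    = subst (λ vs → Unique (vs ++ pendants)) (sym (verts-swap inner)) (unique-↭ perm unique)
    ; covers    = λ v → subst (λ vs → v ∈ vs ++ pendants) (sym (verts-swap inner)) (∈-resp-↭ perm (covers v))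
    ; inParent  = λ {_} {z} i → subst (z ∈_) (sym (verts-swap inner)) (outParent i)
    ; outParent = λ {_} {z} i → subst (z ∈_) (sym (verts-swap inner)) (inParent i)
    ; classify  = λ a → [ inj₁ ∘ arcs-swap inner , [ inj₂ ∘ inj₂ , inj₂ ∘ inj₁ ]′ ]′ (classify a)
    }
    where
    open Dissection δ
    pendants = map proj₁ outLeaves ++ map proj₁ inLeaves
    perm = ++⁺ˡ (verts inner) (↭ₚ.++-comm (map proj₁ inLeaves) (map proj₁ outLeaves))

  module _ {V W : Set} (_≟ⱽ_ : DecidableEquality V) (_≟_ : DecidableEquality W) (arc : W → W → Bool) where

    open Embedding _≟ⱽ_ _≟_
    open Order arc

    record Partial (D : V → V → Bool) (φ : V → W) (S : List V) : Set where
      field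
        inj : ∀ {u v} → u ∈ S → v ∈ S → φ u ≡ φ v → u ≡ v
        hom : ∀ {u v} → u ∈ S → v ∈ S → T (D u v) → T (arc (φ u) (φ v))

    module _ {D : V → V → Bool} where

      Pendant : V × V → Set
      Pendant (y , z) = (∀ {u} → ¬ T (D y u)) × (∀ {u} → T (D u y) → u ≡ z)

      addLeaf : ∀ {φ S y z x} → Partial D φ S → z ∈ S → y ∉ S → Pendant (y , z) → T (arc (φ z) x) → x ∉ map φ S →
                Partial D (φ [ y ∷ [] ↦ (λ _ → x) ]) (y ∷ S)
      addLeaf {φ} {S} {y} {z} {x} π z∈ y∉ (no-out , only-z) z→x x∉ = record { inj = inj′ ; hom = hom′ }
        where
        open Partial π
        φ′ = φ [ y ∷ [] ↦ (λ _ → x) ]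
        at-y : φ′ y ≡ x
        at-y = update-∈ φ {y ∷ []} (λ _ → x) (here refl)
        at : ∀ {v} → v ∈ S → φ′ v ≡ φ v
        at i = update-∉ φ {y ∷ []} (λ _ → x) λ { (here refl) → y∉ i ; (there ()) }
        inj′ : ∀ {u v} → u ∈ y ∷ S → v ∈ y ∷ S → φ′ u ≡ φ′ v → u ≡ v
        inj′ (here refl) (here refl) _ = refl
        inj′ (here refl) (there j)   e = ⊥-elim (x∉ (subst (_∈ map φ S) (trans (sym (at j)) (trans (sym e) at-y)) (∈-map⁺ φ j)))
        inj′ (there i)   (here refl) e = ⊥-elim (x∉ (subst (_∈ map φ S) (trans (sym (at i)) (trans e at-y)) (∈-map⁺ φ i)))
        inj′ (there i)   (there j)   e = inj i j (trans (sym (at i)) (trans e (at j)))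
        hom′ : ∀ {u v} → u ∈ y ∷ S → v ∈ y ∷ S → T (D u v) → T (arc (φ′ u) (φ′ v))
        hom′ (here refl) _           a = ⊥-elim (no-out a)
        hom′ (there i)   (here refl) a with refl ← only-z a = subst₂ (λ p q → T (arc p q)) (sym (at i)) (sym at-y) z→x
        hom′ (there i)   (there j)   a = subst₂ (λ p q → T (arc p q)) (sym (at i)) (sym (at j)) (hom i j a)

      -- Each leaf added takes at most one vertex of `R`, so fewer than `c` of them are occupied
      -- whenever a leaf is to be placed, and a free out-neighbour in `R` exists. Counting
      -- occupation inside `R` only lets the lemma serve both for a reserved set and for the whole
      -- tournament.
      addLeaves : ∀ {φ S} (R : List W) → Unique R → ∀ ls → Unique (map proj₁ ls ++ S) →
                  (∀ {l} → l ∈ ls → Pendant l × proj₂ l ∈ S) → ∀ c → (∀ {l} → l ∈ ls → c ≤ count (arc (φ (proj₂ l))) R) →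
                  count (mem _≟_ (map φ S)) R + length ls ≤ c → Partial D φ S →
                  ∃ λ φ′ → Partial D φ′ (map proj₁ ls ++ S) × (∀ {v} → v ∈ S → φ′ v ≡ φ v) ×
                           count (mem _≟_ (map φ′ (map proj₁ ls ++ S))) R ≤ count (mem _≟_ (map φ S)) R + length ls
      addLeaves {φ} R uR [] u p c deg room π = φ , π , (λ _ → refl) , m≤m+n _ 0
      addLeaves {φ} {S} R uR ((y , z) ∷ ls) (y∉ ∷ u) p c deg room π
        with addLeaves R uR ls u (p ∘ there) c (deg ∘ there) (≤-trans (+-monoʳ-≤ _ (n≤1+n _)) room) π
      ... | φ₁ , π₁ , agree , used = φ′ , addLeaf π₁ z∈ y∉S pendant z→x x∉ , agree′ , used′
        where
        S₁ = map proj₁ ls ++ S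
        K  = map φ₁ S₁
        pendant = proj₁ (p (here refl))
        z∈S = proj₂ (p (here refl))
        z∈ : z ∈ S₁
        z∈ = ∈-++⁺ʳ (map proj₁ ls) z∈S
        y∉S : y ∉ S₁
        y∉S i = All.lookup y∉ i refl
        usable : W → Bool
        usable x = arc (φ₁ z) x ∧ not (mem _≟_ K x)
        split : ∀ {x} → T (arc (φ₁ z) x) → T (usable x) ⊎ T (mem _≟_ K x)
        split {x} t with mem _≟_ K x
        ... | true  = inj₂ _
        ... | false = inj₁ (Equivalence.from T-∧ (t , _))
        some : 0 < count usable R
        some = +-cancelʳ-≤ (count (mem _≟_ K) R) 1 (count usable R) (begin
          suc (count (mem _≟_ K) R)                ≤⟨ s≤s used ⟩
          suc (count (mem _≟_ (map φ S)) R + length ls) ≡⟨ sym (+-suc _ (length ls)) ⟩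
          count (mem _≟_ (map φ S)) R + suc (length ls) ≤⟨ room ⟩
          c                                        ≤⟨ deg (here refl) ⟩
          count (arc (φ z)) R                      ≡⟨ cong (λ w → count (arc w) R) (sym (agree z∈S)) ⟩
          count (arc (φ₁ z)) R                     ≤⟨ count-⊎ {q = usable} {r = mem _≟_ K} R (λ _ → split) ⟩
          count usable R + count (mem _≟_ K) R     ∎)
          where open ≤-Reasoning
        found = count-pos usable R some
        x = proj₁ found
        z→x : T (arc (φ₁ z) x)
        z→x = proj₁ (Equivalence.to T-∧ (proj₂ (proj₂ found)))
        x∉ : x ∉ K
        x∉ i with mem _≟_ K x | mem⁺ _≟_ i | proj₂ (Equivalence.to (T-∧ {arc (φ₁ z) x}) (proj₂ (proj₂ found)))
        ... | true | _ | ()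
        φ′ = φ₁ [ y ∷ [] ↦ (λ _ → x) ]
        old : ∀ {v} → v ∈ S₁ → φ′ v ≡ φ₁ v
        old i = update-∉ φ₁ {y ∷ []} (λ _ → x) λ { (here refl) → y∉S i ; (there ()) }
        agree′ : ∀ {v} → v ∈ S → φ′ v ≡ φ v
        agree′ i = trans (old (∈-++⁺ʳ (map proj₁ ls) i)) (agree i)
        images : map φ′ (y ∷ S₁) ≡ x ∷ K
        images = cong₂ _∷_ (update-∈ φ₁ {y ∷ []} (λ _ → x) (here refl)) (map-cong-local (All.tabulate old))
        used′ : count (mem _≟_ (map φ′ (y ∷ S₁))) R ≤ count (mem _≟_ (map φ S)) R + suc (length ls)
        used′ = begin
          count (mem _≟_ (map φ′ (y ∷ S₁))) R ≡⟨ cong (λ L → count (mem _≟_ L) R) images ⟩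
          count (mem _≟_ (x ∷ K)) R ≤⟨ count-⊎ {q = λ w → does (w ≟ x)} {r = mem _≟_ K} R (λ _ → Equivalence.to T-∨) ⟩
          count (λ w → does (w ≟ x)) R + count (mem _≟_ K) R ≤⟨ +-mono-≤ (count-≟ _≟_ x R uR) used ⟩
          suc (count (mem _≟_ (map φ S)) R + length ls) ≡⟨ sym (+-suc _ (length ls)) ⟩
          count (mem _≟_ (map φ S)) R + suc (length ls) ∎
          where open ≤-Reasoning

    module _ (complete : ∀ {x y} → x ≢ y → T (arc x y) ⊎ T (arc y x)) where

      -- In a local median order every vertex but those of a final segment R of about
      -- half the order has at least c out-neighbours in R.
      sinkSet : ∀ L → Unique L → ∀ c → ∃₂ λ A R → A ++ R ↭ L × length R ≤ (⌈ length L /2⌉ + c) ∸ 1 ×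
                (∀ {w} → w ∈ A → c ≤ count (arc w) R)
      sinkSet L uL c with goodOrder complete L uL
      ... | L′ , perm , good with length L ≤? (⌈ length L /2⌉ + c) ∸ 1
      ... | yes short = [] , L′ , perm , ≤-trans (≤-reflexive (↭-length perm)) short , λ ()
      ... | no  long with take-split (length L ∸ ((⌈ length L /2⌉ + c) ∸ 1)) L′ (≤-trans (m∸n≤m (length L) ((⌈ length L /2⌉ + c) ∸ 1)) (≤-reflexive (sym (↭-length perm))))
      ... | A , R , refl , lenA = A , R , perm , ≤-reflexive lenR , many
        where
        q = length L
        r = (⌈ q /2⌉ + c) ∸ 1
        A+R : length A + length R ≡ q
        A+R = trans (sym (length-++ A)) (↭-length perm)
        lenR : length R ≡ r
        lenR = +-cancelˡ-≡ (length A) _ _ (trans A+R (trans (sym (m∸n+n≡m (<⇒≤ (≰⇒> long)))) (cong (_+ r) (sym lenA))))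
        many : ∀ {w} → w ∈ A → c ≤ count (arc w) R
        many {w} i with ∈-∃++ i
        ... | xs , ys , refl = bound c refl
          where
          k = count (arc w) R
          half : length ys + length R ≤ 2 * (length ys + k)
          half = begin
            length ys + length R  ≡⟨ sym (length-++ ys) ⟩
            length (ys ++ R)      ≤⟨ good-half xs (subst Good (++-assoc xs (w ∷ ys) R) good) (ys ++ R) [] (sym (++-identityʳ _)) ⟩
            2 * count (arc w) (ys ++ R) ≡⟨ cong (2 *_) (count-++ (arc w) ys R) ⟩
            2 * (count (arc w) ys + k)  ≤⟨ *-monoʳ-≤ 2 (+-monoˡ-≤ k (count≤length (arc w) ys)) ⟩
            2 * (length ys + k) ∎
            where open ≤-Reasoning
          ys<A : suc (length ys) + length R ≤ q
          ys<A = ≤-trans (+-monoˡ-≤ (length R) (≤-trans (m≤n+m (suc (length ys)) (length xs)) (≤-reflexive (sym (length-++ xs))))) (≤-reflexive A+R)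
          -- For c = 0 the subtraction in `r` may truncate, but nothing is claimed. For c = 1 + c′
          -- the computation amounts to 2c′ + 1 ≤ 2k, and parity gives c ≤ k.
          bound : ∀ c′ → c ≡ c′ → c′ ≤ k
          bound zero     _    = z≤n
          bound (suc c′) refl = s≤s⁻¹ (*-cancelˡ-< 2 (suc c′) (suc k) (s≤s (+-cancelˡ-≤ (2 * r) _ _ (begin
            2 * r + 2 * suc c′                  ≡⟨ solve 2 (λ r c → con 2 :* r :+ con 2 :* (con 1 :+ c) := con 1 :+ r :+ r :+ con 1 :+ con 2 :* c) refl r c′ ⟩
            suc r + r + 1 + 2 * c′              ≤⟨ +-monoˡ-≤ (2 * c′) (+-monoˡ-≤ 1 twice) ⟩
            q + 2 * k + 1 + 2 * c′              ≤⟨ +-monoˡ-≤ (2 * c′) (+-monoˡ-≤ 1 (+-monoˡ-≤ (2 * k) (≤2*⌈/2⌉ q))) ⟩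
            2 * ⌈ q /2⌉ + 2 * k + 1 + 2 * c′    ≡⟨ solve 3 (λ h k c → con 2 :* h :+ con 2 :* k :+ con 1 :+ con 2 :* c := con 2 :* (h :+ c) :+ (con 1 :+ con 2 :* k)) refl ⌈ q /2⌉ k c′ ⟩
            2 * (⌈ q /2⌉ + c′) + suc (2 * k)    ≡⟨ cong (λ z → 2 * z + suc (2 * k)) (sym r≡) ⟩
            2 * r + suc (2 * k)                 ≡⟨ cong (2 * r +_) (solve 1 (λ k → con 1 :+ con 2 :* k := k :+ con 1 :* (con 1 :+ k)) refl k) ⟩
            2 * r + (k + 1 * suc k) ∎)) ))
            where
            open ≤-Reasoning
            r≡ : r ≡ ⌈ q /2⌉ + c′
            r≡ = cong (_∸ 1) (+-suc ⌈ q /2⌉ c′)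
            -- Since w dominates half of `ys ++ R`, |R| ≤ |ys| + 2k; and w, `ys` and `R` fit into
            -- the q vertices, which eliminates |ys|.
            twice : suc r + r ≤ q + 2 * k
            twice = +-cancelˡ-≤ (length ys) _ _ (begin
              length ys + (suc r + r)     ≡⟨ cong (λ z → length ys + (suc z + z)) (sym lenR) ⟩
              length ys + (suc (length R) + length R) ≡⟨ solve 2 (λ y R → y :+ (con 1 :+ R :+ R) := con 1 :+ y :+ R :+ R) refl (length ys) (length R) ⟩
              suc (length ys) + length R + length R ≤⟨ +-monoˡ-≤ (length R) ys<A ⟩
              q + length R                ≤⟨ +-monoʳ-≤ q (+-cancelˡ-≤ (length ys) _ _ (≤-trans half (≤-reflexive (solve 2 (λ y k → con 2 :* (y :+ k) := y :+ (y :+ con 2 :* k)) refl (length ys) k)))) ⟩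
              q + (length ys + 2 * k)     ≡⟨ solve 3 (λ q y k → q :+ (y :+ k) := y :+ (q :+ k)) refl q (length ys) (2 * k) ⟩
              length ys + (q + 2 * k)     ∎)

  functional : ∀ {A B : Set} (ls : List (A × B)) → Unique (map proj₁ ls) → ∀ {y u z} → (y , u) ∈ ls → (y , z) ∈ ls → u ≡ z
  functional (_ ∷ ls) _        (here refl) (here refl) = refl
  functional (_ ∷ ls) (n ∷ _)  (here refl) (there k)   = ⊥-elim (All.lookup n (∈-map⁺ proj₁ k) refl)
  functional (_ ∷ ls) (n ∷ _)  (there k)   (here refl) = ⊥-elim (All.lookup n (∈-map⁺ proj₁ k) refl)
  functional (_ ∷ ls) (_ ∷ us) (there j)   (there k)   = functional ls us j k

  -- Embedding a dissected tree in a tournament.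

  module Host {V W : Set} (_≟ⱽ_ : DecidableEquality V) (_≟_ : DecidableEquality W)
              (univ : List W) (univ! : Unique univ) (∈univ : ∀ x → x ∈ univ) where

    open Embedding _≟ⱽ_ _≟_
    open Graft _≟ⱽ_

    weak : (W → W → Bool) → ℕ → W → Bool
    weak arc n x = suc (count (arc x) univ) ≤ᵇ n

    Contains : (W → W → Bool) → (V → V → Bool) → Set
    Contains arc D = ∃ λ (φ : V → W) → (∀ {u v : V} → φ u ≡ φ v → u ≡ v) × (∀ {u v} → T (D u v) → T (arc (φ u) (φ v)))

    module _ {arc : W → W → Bool} (complete : ∀ {x y} → x ≢ y → T (arc x y) ⊎ T (arc y x))
             {D : V → V → Bool} (δ : Dissection D) where

      open Dissection δ

      private
        I = map proj₁ inLeaves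
        O = map proj₁ outLeaves
        b = length outLeaves
        q = count (weak arc order) univ

      -- The price of `inner` with the in-leaves grafted on, at the rates of `embed-backward`: an
      -- in-leaf is an arc towards the root and costs only 2.
      firstCost : ℕ
      firstCost = suc (2 * (length inLeaves + ins inner) + 4 * outs inner)

      sinks : ℕ
      sinks = (⌈ q /2⌉ + b) ∸ 1

      module Hosting (A R : List W) (perm : A ++ R ↭ keep (weak arc order) univ)
                     (R≤ : length R ≤ (⌈ length (keep (weak arc order) univ) /2⌉ + b) ∸ 1)
                     (A-strong : ∀ {w} → w ∈ A → b ≤ count (arc w) R)
                     (enough : firstCost + sinks ≤ length univ) where

        U : List W
        U = keep (not ∘ mem _≟_ R) univ
        A++R! : Unique (A ++ R)
        A++R! = unique-↭ (↭-sym perm) (keep-unique _ univ!)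
        R! : Unique R
        R! = unique-++⁻ʳ A A++R!
        t : RT V
        t = graftIns inLeaves inner
        t↭ : verts t ↭ I ++ verts inner
        t↭ = verts-graftIns inLeaves inner
        I++V! : Unique (I ++ verts inner)
        I++V! = unique-↭ (↭ₚ.++-comm (verts inner) I) (unique-++⁻ˡ (verts inner ++ I) (subst Unique (sym (++-assoc (verts inner) I O)) unique))
        U-large : suc (2 * ins t + 4 * outs t) ≤ length U
        U-large = +-cancelʳ-≤ sinks _ _ (begin
          suc (2 * ins t + 4 * outs t) + sinks ≡⟨ cong₂ (λ x y → suc (2 * x + 4 * y) + sinks) (ins-graftIns inLeaves inner) (outs-graftIns inLeaves inner) ⟩
          firstCost + sinks              ≤⟨ enough ⟩
          length univ                    ≡⟨ sym (count-all (λ _ → true) univ (λ _ → _)) ⟩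
          count (λ _ → true) univ        ≤⟨ count-⊎ {q = not ∘ mem _≟_ R} {r = mem _≟_ R} univ (λ {x} _ _ → either (mem _≟_ R x)) ⟩
          count (not ∘ mem _≟_ R) univ + count (mem _≟_ R) univ
            ≤⟨ +-mono-≤ (≤-reflexive (sym (length-keep _ univ))) (count-mem _≟_ R univ univ!) ⟩
          length U + length R            ≤⟨ +-monoʳ-≤ (length U) (subst (λ z → length R ≤ (⌈ z /2⌉ + b) ∸ 1) (length-keep _ univ) R≤) ⟩
          length U + sinks               ∎)
          where
          open ≤-Reasoning
          either : ∀ c → T (not c) ⊎ T c
          either true  = inj₂ _
          either false = inj₁ _
        t! : Unique (verts t)
        t! = unique-↭ (↭-sym t↭) I++V!

        module Extending (φ₀ : V → W) (em : Embeds arc φ₀ t U) where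

          S₀ = I ++ verts inner
          toT : ∀ {v} → v ∈ S₀ → v ∈ verts t
          toT = ∈-resp-↭ (↭-sym t↭)
          O# : ∀ {v} → v ∈ S₀ → v ∉ O
          O# i j = unique-disjoint (verts inner ++ I) (subst Unique (sym (++-assoc (verts inner) I O)) unique)
                     (∈-resp-↭ (↭ₚ.++-comm I (verts inner)) i) j
          -- The tag `true` selects the leaves whose neighbour has an image of outdegree less than
          -- `order`. These form `L₁` and go into `R`; the leaves in `L₂` can go anywhere.
          strong : Bool → V × V → Bool
          strong c (_ , z) = if c then weak arc order (φ₀ z) else not (weak arc order (φ₀ z))
          L₁ = keep (strong true) outLeaves
          L₂ = keep (strong false) outLeaves
          pendant : ∀ {l} → l ∈ outLeaves → Pendant _≟ⱽ_ _≟_ arc {D} l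
          pendant {y , z} i = no-out , only-z
            where
            y∈O : y ∈ O
            y∈O = ∈-map⁺ proj₁ i
            no-out : ∀ {u} → ¬ T (D y u)
            no-out a with classify a
            ... | inj₁ j        = O# (∈-++⁺ʳ I (proj₁ (arc-ends inner j))) y∈O
            ... | inj₂ (inj₁ j) = O# (∈-++⁺ˡ (∈-map⁺ proj₁ j)) y∈O
            ... | inj₂ (inj₂ j) = O# (∈-++⁺ʳ I (outParent j)) y∈O
            only-z : ∀ {u} → T (D u y) → u ≡ z
            only-z a with classify a
            ... | inj₁ j        = ⊥-elim (O# (∈-++⁺ʳ I (proj₂ (arc-ends inner j))) y∈O)
            ... | inj₂ (inj₁ j) = ⊥-elim (O# (∈-++⁺ʳ I (inParent j)) y∈O)
            ... | inj₂ (inj₂ j) = functional outLeaves (unique-++⁻ʳ I (unique-++⁻ʳ (verts inner) unique)) j i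
          π₀ : Partial _≟ⱽ_ _≟_ arc D φ₀ S₀
          π₀ = record { inj = λ i j → Embeds.inj em (toT i) (toT j) ; hom = hom }
            where
            hom : ∀ {u v} → u ∈ S₀ → v ∈ S₀ → T (D u v) → T (arc (φ₀ u) (φ₀ v))
            hom {u} {v} i j a with classify a
            ... | inj₁ k        = Embeds.hom em (arcs-graftIns inLeaves inner k)
            ... | inj₂ (inj₁ k) = Embeds.hom em (leaf-graftIns inLeaves inner inParent k)
            ... | inj₂ (inj₂ k) = ⊥-elim (O# j (∈-map⁺ proj₁ k))
          O! : Unique O
          O! = unique-++⁻ʳ I (unique-++⁻ʳ (verts inner) unique)
          firsts! : ∀ c → Unique (map proj₁ (keep (strong c) outLeaves))
          firsts! c = go outLeaves O!
            where
            go : ∀ ls → Unique (map proj₁ ls) → Unique (map proj₁ (keep (strong c) ls))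
            go [] _ = []
            go (l ∷ ls) (n ∷ u) with strong c l
            ... | false = go ls u
            ... | true  = All.tabulate (λ i → All.lookup n (sub i)) ∷ go ls u
              where
              sub : ∀ {y} → y ∈ map proj₁ (keep (strong c) ls) → y ∈ map proj₁ ls
              sub i with ∈-map⁻ proj₁ i
              ... | l′ , j , refl = ∈-map⁺ proj₁ (proj₁ (∈-keep⁻ (strong c) ls j))
          in-O : ∀ c {y} → y ∈ map proj₁ (keep (strong c) outLeaves) → y ∈ O
          in-O c i with ∈-map⁻ proj₁ i
          ... | l , j , refl = ∈-map⁺ proj₁ (proj₁ (∈-keep⁻ (strong c) outLeaves j))
          total : length L₁ + length L₂ ≡ b
          total = trans (cong₂ _+_ (length-keep (strong true) outLeaves) (length-keep (strong false) outLeaves)) (go outLeaves)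
            where
            go : ∀ ls → count (strong true) ls + count (strong false) ls ≡ length ls
            go [] = refl
            go ((y , z) ∷ ls) with weak arc order (φ₀ z)
            ... | true  = cong suc (go ls)
            ... | false = trans (+-suc _ _) (cong suc (go ls))
          S₁ S₂ : List V
          S₁ = map proj₁ L₁ ++ S₀
          S₂ = map proj₁ L₂ ++ S₁
          -- A weak image lies in `A` or in `R`, and it is not in `R` because `φ₀` maps into `U`.
          deg₁ : ∀ {l} → l ∈ L₁ → b ≤ count (arc (φ₀ (proj₂ l))) R
          deg₁ {y , z} i with ∈-keep⁻ (strong true) outLeaves i
          ... | j , s with ∈-++⁻ A (∈-resp-↭ (↭-sym perm) (∈-keep⁺ (weak arc order) (∈univ (φ₀ z)) s))
          ... | inj₁ k = A-strong k
          ... | inj₂ k = ⊥-elim (not-mem (proj₂ (∈-keep⁻ (not ∘ mem _≟_ R) univ (Embeds.inside em (toT (∈-++⁺ʳ I (outParent j)))))) k)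
            where
            not-mem : ∀ {x} → T (not (mem _≟_ R x)) → x ∉ R
            not-mem {x} n i with mem _≟_ R x | mem⁺ _≟_ i
            ... | true | _ = n
          -- The set `R` was kept free of `φ₀`, and at most b leaves are going to be placed in it.
          room₁ : count (mem _≟_ (map φ₀ S₀)) R + length L₁ ≤ b
          room₁ = ≤-trans (≤-reflexive (cong (_+ length L₁) (count-none _ R outside))) (≤-trans (m≤m+n _ (length L₂)) (≤-reflexive total))
            where
            outside : ∀ {x} → x ∈ R → ¬ T (mem _≟_ (map φ₀ S₀) x)
            outside {x} x∈R m with ∈-map⁻ φ₀ (mem⁻ _≟_ (map φ₀ S₀) m)
            ... | v , j , refl with mem _≟_ R (φ₀ v) | mem⁺ _≟_ x∈R | proj₂ (∈-keep⁻ (not ∘ mem _≟_ R) univ (Embeds.inside em (toT j)))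
            ... | true | _ | ()
          clash : ∀ {l} → T (strong true l) → T (strong false l) → ⊥
          clash {y , z} s s′ with weak arc order (φ₀ z)
          ... | true = s′
          disj : ∀ {y} → y ∈ map proj₁ L₂ → y ∈ S₁ → ⊥
          disj {y} i j with ∈-++⁻ (map proj₁ L₁) j
          ... | inj₂ k = O# k (in-O false i)
          ... | inj₁ k with ∈-map⁻ proj₁ i | ∈-map⁻ proj₁ k
          ... | (_ , z) , i′ , refl | (_ , z′) , k′ , refl with ∈-keep⁻ (strong false) outLeaves i′ | ∈-keep⁻ (strong true) outLeaves k′
          ... | i″ , s | k″ , s′ with functional outLeaves O! i″ k″
          ... | refl = clash {y , z} s′ s
          deg₂ : ∀ (φ₁ : V → W) → (∀ {v} → v ∈ S₀ → φ₁ v ≡ φ₀ v) → ∀ {l} → l ∈ L₂ → order ≤ count (arc (φ₁ (proj₂ l))) univ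
          deg₂ φ₁ agree₁ {y , z} i with ∈-keep⁻ (strong false) outLeaves i
          ... | j , s = subst (λ w → order ≤ count (arc w) univ) (sym (agree₁ (∈-++⁺ʳ I (outParent j)))) (big s)
            where
            big : T (not (weak arc order (φ₀ z))) → order ≤ count (arc (φ₀ z)) univ
            big n with order ≤? count (arc (φ₀ z)) univ
            ... | yes l = l
            ... | no ¬l = ⊥-elim (T-not⇒¬T n (≤⇒≤ᵇ (≰⇒> ¬l)))
          -- The vertices placed so far and those of `L₂` together number `order`, so an outdegree
          -- of `order` is never exhausted.
          room₂ : ∀ φ₁ → count (mem _≟_ (map φ₁ S₁)) univ + length L₂ ≤ order
          room₂ φ₁ = begin
            count (mem _≟_ (map φ₁ S₁)) univ + length L₂ ≤⟨ +-monoˡ-≤ (length L₂) (count-mem _≟_ (map φ₁ S₁) univ univ!) ⟩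
            length (map φ₁ S₁) + length L₂ ≡⟨ cong (_+ length L₂) (trans (length-map φ₁ S₁) (trans (length-++ (map proj₁ L₁)) (cong₂ _+_ (length-map proj₁ L₁) (trans (length-++ I) (cong (_+ length (verts inner)) (length-map proj₁ inLeaves)))))) ⟩
            length L₁ + (length inLeaves + length (verts inner)) + length L₂
              ≡⟨ solve 4 (λ a i v c → a :+ (i :+ v) :+ c := v :+ (i :+ (a :+ c))) refl (length L₁) (length inLeaves) (length (verts inner)) (length L₂) ⟩
            length (verts inner) + (length inLeaves + (length L₁ + length L₂)) ≡⟨ cong (λ z → length (verts inner) + (length inLeaves + z)) total ⟩
            order ∎
            where open ≤-Reasoning
          all : ∀ v → v ∈ S₂
          all v with ∈-++⁻ (verts inner) (covers v)
          ... | inj₁ i = ∈-++⁺ʳ (map proj₁ L₂) (∈-++⁺ʳ (map proj₁ L₁) (∈-++⁺ʳ I i))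
          ... | inj₂ i with ∈-++⁻ I i
          ... | inj₁ j = ∈-++⁺ʳ (map proj₁ L₂) (∈-++⁺ʳ (map proj₁ L₁) (∈-++⁺ˡ j))
          ... | inj₂ j with ∈-map⁻ proj₁ j
          ... | (y , z) , k , refl with weak arc order (φ₀ z) in eq
          ... | true  = ∈-++⁺ʳ (map proj₁ L₂) (∈-++⁺ˡ (∈-map⁺ proj₁ (∈-keep⁺ (strong true) k (subst T (sym eq) _))))
          ... | false = ∈-++⁺ˡ (∈-map⁺ proj₁ (∈-keep⁺ (strong false) k (subst (T ∘ not) (sym eq) _)))

          u₁ : Unique S₁
          u₁ = unique-++⁺ (firsts! true) I++V! (λ i j → O# j (in-O true i))
          chosen : ∀ c {l} → l ∈ keep (strong c) outLeaves → l ∈ outLeaves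
          chosen c = proj₁ ∘ ∈-keep⁻ (strong c) outLeaves

          finish : Contains arc D
          finish with addLeaves _≟ⱽ_ _≟_ arc R R! L₁ u₁
                        (λ i → pendant (chosen true i) , ∈-++⁺ʳ I (outParent (chosen true i))) b deg₁ room₁ π₀
          ... | φ₁ , π₁ , agree₁ , _ with addLeaves _≟ⱽ_ _≟_ arc univ univ! L₂ (unique-++⁺ (firsts! false) u₁ disj)
                        (λ i → pendant (chosen false i) , ∈-++⁺ʳ (map proj₁ L₁) (∈-++⁺ʳ I (outParent (chosen false i))))
                        order (deg₂ φ₁ agree₁) (room₂ φ₁) π₁
          ... | φ₂ , π₂ , _ = φ₂ , (λ {u} {v} → Partial.inj π₂ (all u) (all v)) , λ {u} {v} → Partial.hom π₂ (all u) (all v)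

      contains : firstCost + sinks ≤ length univ → Contains arc D
      contains enough with sinkSet _≟ⱽ_ _≟_ arc complete (keep (weak arc order) univ) (keep-unique _ univ!) b
      ... | A , R , perm , R≤ , A-strong =
        let open Hosting A R perm R≤ A-strong enough
            φ₀ , em = embed-backward complete t t! U (keep-unique _ univ!) U-large
        in Extending.finish φ₀ em

    -- Adding the two failures gives `large`, that is, r + s ≥ 2(a + b) + 2e. Since the even number
    -- N = 2m bounds p + q, the two halves sum to at most m + 1, and subtracting 1 from each of r
    -- and s leaves r + s one below that value.
    costs-incompatible : ∀ {N p q r s} (i o a b e : ℕ) → e ≡ i + o → N ≡ 2 * (a + b) + 4 * e → 1 ≤ e → p + q ≤ N →
                 r ≡ (⌈ q /2⌉ + b) ∸ 1 → s ≡ (⌈ p /2⌉ + a) ∸ 1 →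
                 N < suc (2 * (a + i) + 4 * o) + r → N < suc (2 * (b + o) + 4 * i) + s → ⊥
    costs-incompatible {N} {p} {q} {r} {s} i o a b e refl refl 1≤e p+q≤N refl refl f₁ f₂ = <⇒≱ small large
      where
      open ≤-Reasoning
      m = a + b + 2 * e
      large : 2 * (a + b) + 2 * e ≤ r + s
      large = +-cancelˡ-≤ (2 + 2 * (a + b) + 6 * e) _ _ (begin
        2 + 2 * (a + b) + 6 * e + (2 * (a + b) + 2 * e) ≡⟨ solve 2 (λ k e → con 2 :+ con 2 :* k :+ con 6 :* e :+ (con 2 :* k :+ con 2 :* e) := con 1 :+ (con 2 :* k :+ con 4 :* e) :+ (con 1 :+ (con 2 :* k :+ con 4 :* e))) refl (a + b) e ⟩
        suc N + suc N ≤⟨ +-mono-≤ f₁ f₂ ⟩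
        suc (2 * (a + i) + 4 * o) + r + (suc (2 * (b + o) + 4 * i) + s) ≡⟨ solve 6 (λ a b i o r s → con 1 :+ (con 2 :* (a :+ i) :+ con 4 :* o) :+ r :+ (con 1 :+ (con 2 :* (b :+ o) :+ con 4 :* i) :+ s) := con 2 :+ con 2 :* (a :+ b) :+ con 6 :* (i :+ o) :+ (r :+ s)) refl a b i o r s ⟩
        2 + 2 * (a + b) + 6 * e + (r + s) ∎)
      half-sum : ⌈ q /2⌉ + ⌈ p /2⌉ ≤ suc m
      half-sum = *-cancelˡ-≤ 2 (begin
        2 * (⌈ q /2⌉ + ⌈ p /2⌉) ≡⟨ *-distribˡ-+ 2 ⌈ q /2⌉ ⌈ p /2⌉ ⟩
        2 * ⌈ q /2⌉ + 2 * ⌈ p /2⌉ ≤⟨ +-mono-≤ (2*⌈/2⌉≤ q) (2*⌈/2⌉≤ p) ⟩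
        suc q + suc p ≡⟨ solve 2 (λ p q → con 1 :+ q :+ (con 1 :+ p) := con 2 :+ (p :+ q)) refl p q ⟩
        2 + (p + q) ≤⟨ +-monoʳ-≤ 2 p+q≤N ⟩
        2 + N ≡⟨ solve 2 (λ k e → con 2 :+ (con 2 :* k :+ con 4 :* e) := con 2 :* (con 1 :+ (k :+ con 2 :* e))) refl (a + b) e ⟩
        2 * suc m ∎)
      half-one : ∀ {x} → x ≤ N → ⌈ x /2⌉ ≤ m
      half-one {x} x≤N = s≤s⁻¹ (*-cancelˡ-< 2 ⌈ x /2⌉ (suc m) (begin-strict
        2 * ⌈ x /2⌉ ≤⟨ 2*⌈/2⌉≤ x ⟩
        suc x ≤⟨ s≤s x≤N ⟩
        suc N <⟨ ≤-refl ⟩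
        2 + N ≡⟨ solve 2 (λ k e → con 2 :+ (con 2 :* k :+ con 4 :* e) := con 2 :* (con 1 :+ (k :+ con 2 :* e))) refl (a + b) e ⟩
        2 * suc m ∎))
      -- Where `∸ 1` truncates, the bound on the sum loses a unit. The bounds on the single terms
      -- replace it if one of them is zero, and 1 ≤ e if both are.
      bound : ∀ x y → x + y ≤ suc m + (a + b) → x ≤ m + (a + b) → y ≤ m + (a + b) → (x ∸ 1) + (y ∸ 1) < 2 * (a + b) + 2 * e
      bound zero zero _ _ _ = ≤-trans (≤-trans 1≤e (m≤m+n e (e + 0))) (m≤n+m (2 * e) (2 * (a + b)))
      bound zero (suc y) _ _ h = ≤-trans h (≤-reflexive (solve 2 (λ k e → k :+ con 2 :* e :+ k := con 2 :* k :+ con 2 :* e) refl (a + b) e))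
      bound (suc x) zero _ h _ = ≤-trans (s≤s (≤-reflexive (+-identityʳ x))) (≤-trans h (≤-reflexive (solve 2 (λ k e → k :+ con 2 :* e :+ k := con 2 :* k :+ con 2 :* e) refl (a + b) e)))
      bound (suc x) (suc y) h _ _ = ≤-trans (≤-reflexive (sym (+-suc x y))) (≤-trans (s≤s⁻¹ h) (≤-reflexive (solve 2 (λ k e → k :+ con 2 :* e :+ k := con 2 :* k :+ con 2 :* e) refl (a + b) e)))
      small : r + s < 2 * (a + b) + 2 * e
      small = bound (⌈ q /2⌉ + b) (⌈ p /2⌉ + a)
        (≤-trans (≤-reflexive (solve 4 (λ x y a b → x :+ b :+ (y :+ a) := x :+ y :+ (a :+ b)) refl ⌈ q /2⌉ ⌈ p /2⌉ a b)) (+-monoˡ-≤ (a + b) half-sum))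
        (+-mono-≤ (half-one (≤-trans (m≤n+m q p) p+q≤N)) (m≤n+m b a))
        (+-mono-≤ (half-one (≤-trans (m≤m+n p q) p+q≤N)) (m≤m+n a b))

    module _ {arc : W → W → Bool} (complete : ∀ {x y} → x ≢ y → T (arc x y) ⊎ T (arc y x))
             {D : V → V → Bool} (δ : Dissection D) where

      open Dissection δ

      in+out-degree : ∀ x → length univ ≤ suc (count (arc x) univ + count (flip arc x) univ)
      in+out-degree x = begin
        length univ ≡⟨ sym (count-all (λ _ → true) univ (λ _ → _)) ⟩
        count (λ _ → true) univ ≤⟨ count-⊎ {q = λ y → does (y ≟ x)} {r = λ y → arc x y ∨ arc y x} univ (λ {y} _ _ → cases y) ⟩
        count (λ y → does (y ≟ x)) univ + count (λ y → arc x y ∨ arc y x) univ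
          ≤⟨ +-mono-≤ (count-≟ _≟_ x univ univ!) (count-⊎ {q = arc x} {r = flip arc x} univ (λ _ → Equivalence.to T-∨)) ⟩
        suc (count (arc x) univ + count (flip arc x) univ) ∎
        where
        open ≤-Reasoning
        cases : ∀ y → T (does (y ≟ x)) ⊎ T (arc x y ∨ arc y x)
        cases y with y ≟ x
        ... | yes _ = inj₁ _
        ... | no  n = inj₂ (Equivalence.from T-∨ (complete (n ∘ sym)))

      private
        complete⁻ : ∀ {x y} → x ≢ y → T (arc y x) ⊎ T (arc x y)
        complete⁻ n = complete (n ∘ sym)
        δ⁻ = reverse δ
        a = length inLeaves
        b = length outLeaves
        p q : ℕ
        p = count (weak (flip arc) order) univ
        q = count (weak arc order) univ

      firstCost-reverse : firstCost complete⁻ δ⁻ ≡ suc (2 * (b + outs inner) + 4 * ins inner)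
      firstCost-reverse = cong₂ (λ x y → suc (2 * (b + x) + 4 * y)) (ins-swap inner) (outs-swap inner)

      order-reverse : Dissection.order δ⁻ ≡ order
      order-reverse = cong₂ _+_ (cong length (verts-swap inner)) (+-comm b a)

      sinks-reverse : sinks complete⁻ δ⁻ ≡ (⌈ p /2⌉ + a) ∸ 1
      sinks-reverse = cong (λ n → (⌈ count (weak (flip arc) n) univ /2⌉ + a) ∸ 1) order-reverse

      module _ (1≤e : 1 ≤ edges inner) (size : length univ ≡ 2 * (a + b) + 4 * edges inner) where

        -- As n = a + b + e + 1, the difference N - 2n is 2e - 2; this is where a second inner
        -- vertex matters.
        2n≤N : 2 * order ≤ length univ
        2n≤N = begin
          2 * order ≡⟨ cong (λ z → 2 * (z + (a + b))) (length-verts inner) ⟩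
          2 * (suc (edges inner) + (a + b)) ≡⟨ solve 2 (λ e k → con 2 :* (con 1 :+ e :+ k) := con 2 :* k :+ con 2 :* e :+ con 2) refl (edges inner) (a + b) ⟩
          2 * (a + b) + 2 * edges inner + 2 ≤⟨ +-monoʳ-≤ (2 * (a + b) + 2 * edges inner) (*-monoʳ-≤ 2 1≤e) ⟩
          2 * (a + b) + 2 * edges inner + 2 * edges inner ≡⟨ solve 2 (λ e k → con 2 :* k :+ con 2 :* e :+ con 2 :* e := con 2 :* k :+ con 4 :* e) refl (edges inner) (a + b) ⟩
          2 * (a + b) + 4 * edges inner ≡⟨ sym size ⟩
          length univ ∎
          where open ≤-Reasoning

        weak⇒ : ∀ g x → T (weak g order x) → suc (count (g x) univ) ≤ order
        weak⇒ g x = ≤ᵇ⇒≤ _ _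

        -- Outdegree and indegree both below n would sum to at most 2n - 2, but they sum to at least
        -- N - 1.
        exclusive : ∀ x → T (weak arc order x) → ¬ T (weak (flip arc) order x)
        exclusive x t t′ = <⇒≱ (≤-trans (≤-reflexive (sym (+-suc (suc (count (arc x) univ)) (count (flip arc x) univ))))
            (≤-trans (+-mono-≤ (weak⇒ arc x t) (weak⇒ (flip arc) x t′)) (≤-trans (≤-reflexive (cong (order +_) (sym (+-identityʳ order)))) 2n≤N)))
          (in+out-degree x)

        weak-few : p + q ≤ length univ
        weak-few = go univ
          where
          go : ∀ xs → count (weak (flip arc) order) xs + count (weak arc order) xs ≤ length xs
          go [] = z≤n
          go (x ∷ xs) = ≤-trans (≤-reflexive (solve 4 (λ a b c d → a :+ b :+ (c :+ d) := a :+ c :+ (b :+ d)) refl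
              (bit (weak (flip arc) order x)) (count (weak (flip arc) order) xs) (bit (weak arc order x)) (count (weak arc order) xs)))
            (+-mono-≤ (one (weak (flip arc) order x) (weak arc order x) (λ u v → exclusive x v u)) (go xs))
            where
            one : ∀ c d → (T c → T d → ⊥) → bit c + bit d ≤ 1
            one true  true  h = ⊥-elim (h _ _)
            one true  false _ = ≤-refl
            one false true  _ = ≤-refl
            one false false _ = z≤n

        unflip : Contains (flip arc) (flip D) → Contains arc D
        unflip (φ , inj , hom) = φ , inj , hom

        contains-tree : Contains arc D
        contains-tree = choose (_ ≤? _) (_ ≤? _)
          where
          choose : Dec (firstCost complete δ + sinks complete δ ≤ length univ) →
                   Dec (firstCost complete⁻ δ⁻ + sinks complete⁻ δ⁻ ≤ length univ) → Contains arc D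
          choose (yes enough) _            = contains complete δ enough
          choose (no _)       (yes enough) = unflip (contains complete⁻ δ⁻ enough)
          choose (no few)     (no few⁻)    = ⊥-elim (costs-incompatible {length univ} {p} {q} {sinks complete δ} {sinks complete⁻ δ⁻}
            (ins inner) (outs inner) a b (edges inner) (+-comm (outs inner) (ins inner)) size 1≤e weak-few refl sinks-reverse
            (≰⇒> few) (subst (λ c → length univ < c + sinks complete⁻ δ⁻) firstCost-reverse (≰⇒> few⁻)))

  -- Dissecting an oriented tree.

  last-∷ : ∀ {A : Set} (x : A) ys {v} → last ys ≡ just v → last (x ∷ ys) ≡ just v
  last-∷ x (y ∷ ys) e = e

  last-∷ʳ : ∀ {A : Set} (xs : List A) {v} → last (xs ∷ʳ v) ≡ just v
  last-∷ʳ []           = refl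
  last-∷ʳ (x ∷ [])     = refl
  last-∷ʳ (x ∷ y ∷ xs) = last-∷ʳ (y ∷ xs)

  unique-⊆-length : ∀ {A : Set} (_≟_ : (x y : A) → Dec (x ≡ y)) {K L : List A} → Unique K →
                    (∀ {x} → x ∈ K → x ∈ L) → length K ≤ length L
  unique-⊆-length _≟_ {K} {L} uK sub =
    ≤-trans (≤-reflexive (sym (count-all (mem _≟_ L) K (mem⁺ _≟_ ∘ sub)))) (count-mem _≟_ L K uK)

  card-tabulate : ∀ {n} {A : Set} (g : Fin n → A) (p : A → Bool) → ∣ Vec.tabulate (p ∘ g) ∣ ≡ count p (List.tabulate g)
  card-tabulate {zero}  g p = refl
  card-tabulate {suc n} g p with p (g zero)
  ... | true  = cong suc (card-tabulate (g ∘ suc) p)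
  ... | false = card-tabulate (g ∘ suc) p

  module Tree {n : ℕ} (D : Digraph n) (tree : IsOrientedTree (Arc D)) where

    open IsOrientedTree tree
    open Graft {Fin n} Fin._≟_

    infix 4 _~_
    _~_ : Fin n → Fin n → Set
    _~_ = SymClosure (Arc D)

    ~-sym : ∀ {u v} → u ~ v → v ~ u
    ~-sym = symmetric (Arc D)

    isLeaf : Fin n → Bool
    isLeaf v = does (degree D v ℕ.≟ 1)

    -- Stated as not being a leaf, so that the vertex of a one-vertex tree, of degree 0, is inner as
    -- well.
    Inner : Fin n → Set
    Inner v = T (not (isLeaf v))

    ¬inner⇒leaf : ∀ {v} → ¬ Inner v → T (isLeaf v)
    ¬inner⇒leaf {v} ni with T? (isLeaf v)
    ... | yes l = l
    ... | no ¬l = ⊥-elim (ni (¬T⇒T-not ¬l))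

    two-neighbours : ∀ {v x y} → v ~ x → v ~ y → x ≢ y → Inner v
    two-neighbours {v} {x} {y} v~x v~y x≢y = ¬T⇒T-not λ leaf →
      <-irrefl refl (≤-trans two (≤-reflexive (trans (sym deg) (≡ᵇ⇒≡ (degree D v) 1 leaf))))
      where
      nbrs = keep (D v) (allFin n) ++ keep (flip D v) (allFin n)
      deg : degree D v ≡ length nbrs
      deg = trans (cong₂ _+_ (card-tabulate id (D v)) (card-tabulate id (flip D v)))
        (sym (trans (length-++ (keep (D v) (allFin n))) (cong₂ _+_ (length-keep (D v) (allFin n)) (length-keep (flip D v) (allFin n)))))
      nbr : ∀ {w} → v ~ w → w ∈ nbrs
      nbr {w} (fwd a) = ∈-++⁺ˡ (∈-keep⁺ (D v) (∈-allFin w) a)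
      nbr {w} (bwd a) = ∈-++⁺ʳ (keep (D v) (allFin n)) (∈-keep⁺ (flip D v) (∈-allFin w) a)
      two : 2 ≤ length nbrs
      two = unique-⊆-length Fin._≟_ {x ∷ y ∷ []} ((x≢y ∷ []) ∷ [] ∷ []) λ
        { (here refl) → nbr v~x ; (there (here refl)) → nbr v~y }

    leaf-neighbour : ∀ {v x y} → T (isLeaf v) → v ~ x → v ~ y → x ≡ y
    leaf-neighbour {v} {x} {y} leaf v~x v~y with x Fin.≟ y
    ... | yes e = e
    ... | no ne = ⊥-elim (T-not⇒¬T (two-neighbours v~x v~y ne) leaf)

    -- Read off from the first vertices of the path from u to v; w is the third one.
    second : ∀ {u v} → u ≢ v → ∃ λ y → u ~ y × (y ≡ v ⊎ ∃ λ w → y ~ w × w ≢ u)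
    second {u} {v} u≢v with connected u v
    ... | record { vertices = x ∷ [] ; starts = refl ; ends = refl } = ⊥-elim (u≢v refl)
    ... | record { vertices = x ∷ y ∷ [] ; starts = refl ; ends = refl ; linked = l ∷ _ } = y , l , inj₁ refl
    ... | record { vertices = x ∷ y ∷ w ∷ _ ; starts = refl ; linked = l ∷ m ∷ _ ; unique = (_ ∷ x≢w ∷ _) ∷ _ } =
      y , l , inj₂ (w , m , x≢w ∘ sym)

    -- A path leaving S does so at a vertex that is inner, as soon as its end is.
    crossing : ∀ (S : List (Fin n)) {v} x xs → Linked _~_ (x ∷ xs) → last (x ∷ xs) ≡ just v → Unique (x ∷ xs) →
               x ∈ S → v ∉ S → Inner v → ∃₂ λ z y → z ∈ S × y ∉ S × z ~ y × Inner y
    crossing S x [] _ refl _ x∈ v∉ _ = ⊥-elim (v∉ x∈)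
    crossing S x (y ∷ xs) (l ∷ ls) e ((_ ∷ x∉) ∷ u) x∈ v∉ iv with T? (mem Fin._≟_ S y)
    ... | yes t = crossing S y xs ls e u (mem⁻ Fin._≟_ S t) v∉ iv
    ... | no ¬t = x , y , x∈ , ¬t ∘ mem⁺ Fin._≟_ , l , inner xs ls e x∉
      where
      inner : ∀ xs → Linked _~_ (y ∷ xs) → last (y ∷ xs) ≡ just _ → All (x ≢_) xs → Inner y
      inner []       _       refl _         = iv
      inner (w ∷ ws) (m ∷ _) _    (x≢w ∷ _) = two-neighbours (~-sym l) m x≢w

    -- A path that stays within `S`, so that a vertex outside `S` can be added to it to close a
    -- cycle without repetition.
    record Route (S : List (Fin n)) (u v : Fin n) : Set where
      field
        {tail}  : List (Fin n)
        linked  : Linked _~_ (u ∷ tail)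
        ends    : last (u ∷ tail) ≡ just v
        unique  : Unique (u ∷ tail)
        within  : ∀ {w} → w ∈ u ∷ tail → w ∈ S

    -- Two different neighbours of y joined by a route that avoids y would give a cycle.
    one-neighbour : ∀ {S y u z} → Route S z u → y ∉ S → y ~ z → y ~ u → u ≡ z
    one-neighbour {S} {y} {u} {z} ρ y∉ y~z y~u = go ρ
      where
      go : Route S z u → u ≡ z
      go record { tail = [] ; ends = refl } = refl
      go record { tail = w ∷ ws ; linked = l ; ends = e ; unique = un ; within = in-S } = ⊥-elim (acyclic record
        { base   = y
        ; rest   = z ∷ w ∷ ws
        ; long   = s≤s (s≤s z≤n)
        ; linked = y~z ∷ Linked.++⁺ l (subst (λ m → Connected _~_ m (just y)) (sym e) (just (~-sym y~u))) [-]
        ; unique = All.tabulate (λ i y≡ → y∉ (in-S (subst (_∈ _) (sym y≡) i))) ∷ un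
        })

    -- A stage in the growth of a rooted tree on inner vertices. The field `route` keeps it
    -- connected within itself, which through `one-neighbour` ensures that a new vertex contributes
    -- a single arc and `hasArc` survives.
    record Grown : Set where
      field
        t      : RT (Fin n)
        once   : Unique (verts t)
        inner  : ∀ {v} → v ∈ verts t → Inner v
        hasArc : ∀ {u v} → u ∈ verts t → v ∈ verts t → T (D u v) → (u , v) ∈ arcs t
        route  : ∀ {u v} → u ∈ verts t → v ∈ verts t → Route (verts t) u v

    start : ∀ r → Inner r → Grown
    start r ir = record
      { t = dot r ; once = [] ∷ [] ; inner = λ { (here refl) → ir }
      ; hasArc = λ { (here refl) (here refl) a → ⊥-elim (asymmetric a a) }
      ; route  = λ { (here refl) (here refl) → record { linked = [-] ; ends = refl ; unique = [] ∷ [] ; within = id } } }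

    grow : (g : Grown) → ∀ {z y} → z ∈ verts (Grown.t g) → y ∉ verts (Grown.t g) → z ~ y → Inner y →
           ∃ λ g′ → length (verts (Grown.t g′)) ≡ suc (length (verts (Grown.t g)))
    grow g {z} {y} z∈ y∉ z~y iy = record
      { t      = t′
      ; once   = unique-↭ (↭-sym perm) (All.tabulate (λ i e → y∉ (subst (_∈ verts t) (sym e) i)) ∷ once)
      ; inner  = inner′ ∘ from
      ; hasArc = λ i j → hasArc′ (from i) (from j)
      ; route  = λ i j → widen (route′ (from i) (from j))
      } , ↭-length perm
      where
      open Grown g
      dir : z ~ y → Bool
      dir (fwd _) = true
      dir (bwd _) = false
      d = dir z~y
      t′ = graft d y z t
      perm : verts t′ ↭ y ∷ verts t
      perm = verts-graft d y z t
      from : ∀ {v} → v ∈ verts t′ → v ∈ y ∷ verts t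
      from = ∈-resp-↭ perm
      inner′ : ∀ {v} → v ∈ y ∷ verts t → Inner v
      inner′ (here refl) = iy
      inner′ (there i)   = inner i
      attached : ∀ {u} → u ∈ verts t → y ~ u → u ≡ z
      attached i y~u = one-neighbour (route z∈ i) y∉ (~-sym z~y) y~u
      newArc : ∀ (l : z ~ y) → (T (D z y) → (z , y) ∈ arcs (graft (dir l) y z t)) × (T (D y z) → (y , z) ∈ arcs (graft (dir l) y z t))
      newArc (fwd a) = (λ _ → arc-graft true y z t z∈) , (λ b → ⊥-elim (asymmetric a b))
      newArc (bwd a) = (λ b → ⊥-elim (asymmetric a b)) , (λ _ → arc-graft false y z t z∈)
      hasArc′ : ∀ {u v} → u ∈ y ∷ verts t → v ∈ y ∷ verts t → T (D u v) → (u , v) ∈ arcs t′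
      hasArc′ (here refl) (here refl) a = ⊥-elim (asymmetric a a)
      hasArc′ (here refl) (there j)   a with attached j (fwd a)
      ... | refl = proj₂ (newArc z~y) a
      hasArc′ (there i)   (here refl) a with attached i (bwd a)
      ... | refl = proj₁ (newArc z~y) a
      hasArc′ (there i)   (there j)   a = arcs-graft d y z t (hasArc i j a)
      widen : ∀ {u v} → Route (y ∷ verts t) u v → Route (verts t′) u v
      widen ρ = record { linked = linked ; ends = ends ; unique = unique ; within = ∈-resp-↭ (↭-sym perm) ∘ within }
        where open Route ρ
      ∉⇒All : ∀ {xs} → (∀ {w} → w ∈ xs → w ∈ verts t) → All (y ≢_) xs
      ∉⇒All sub = All.tabulate (λ i e → y∉ (subst (_∈ verts t) (sym e) (sub i)))
      route′ : ∀ {u v} → u ∈ y ∷ verts t → v ∈ y ∷ verts t → Route (y ∷ verts t) u v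
      route′ (here refl) (here refl) = record { linked = [-] ; ends = refl ; unique = [] ∷ [] ; within = λ { (here refl) → here refl } }
      route′ (here refl) (there j) = record
        { linked = ~-sym z~y ∷ linked ; ends = last-∷ y (z ∷ tail) ends ; unique = ∉⇒All within ∷ unique
        ; within = λ { (here refl) → here refl ; (there i) → there (within i) } }
        where open Route (route z∈ j)
      route′ {u} (there i) (here refl) = record
        { tail   = tail ∷ʳ y
        ; linked = Linked.++⁺ linked (subst (λ m → Connected _~_ m (just y)) (sym ends) (just z~y)) [-]
        ; ends   = last-∷ʳ (u ∷ tail)
        ; unique = unique-++⁺ unique ([] ∷ []) (λ { k (here refl) → y∉ (within k) })
        ; within = λ k → [ there ∘ within , (λ { (here refl) → here refl }) ]′ (∈-++⁻ (u ∷ tail) k) }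
        where open Route (route i z∈)
      route′ (there i) (there j) = record { linked = linked ; ends = ends ; unique = unique ; within = there ∘ within }
        where open Route (route i j)

    absent : RT (Fin n) → Fin n → Bool
    absent t v = not (isLeaf v) ∧ not (mem Fin._≟_ (verts t) v)

    absent⁺ : ∀ t {v} → Inner v → v ∉ verts t → T (absent t v)
    absent⁺ t iv v∉ = Equivalence.from T-∧ (iv , ¬T⇒T-not (v∉ ∘ mem⁻ Fin._≟_ (verts t)))

    absent⁻ : ∀ t {v} → T (absent t v) → Inner v × v ∉ verts t
    absent⁻ t {v} a with Equivalence.to (T-∧ {not (isLeaf v)}) a
    ... | iv , m = iv , λ i → T-not⇒¬T m (mem⁺ Fin._≟_ i)

    -- While some inner vertex is absent, the path to it from the root leaves the tree at an inner
    -- vertex by `crossing`, and that vertex is grafted on. The size increases each time and cannot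
    -- exceed n, so n is enough fuel.
    spanning : ∀ r → Inner r → ∃ λ g → ∀ {v} → Inner v → v ∈ verts (Grown.t g)
    spanning r ir = go n (start r ir) (n≤1+n n)
      where
      go : ∀ fuel g → n ≤ length (verts (Grown.t g)) + fuel → ∃ λ g → ∀ {v} → Inner v → v ∈ verts (Grown.t g)
      go fuel g b with count (absent (Grown.t g)) (allFin n) in eq
      ... | zero = g , present
        where
        open Grown g using (t)
        none : ∀ xs {v : Fin n} → length xs ≡ 0 → v ∉ xs
        none (_ ∷ _) () _
        present : ∀ {v} → Inner v → v ∈ verts t
        present {v} iv with T? (mem Fin._≟_ (verts t) v)
        ... | yes m = mem⁻ Fin._≟_ (verts t) m
        ... | no ¬m = ⊥-elim (none (keep (absent t) (allFin n)) (trans (length-keep (absent t) (allFin n)) eq)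
                        (∈-keep⁺ (absent t) (∈-allFin v) (absent⁺ t iv (¬m ∘ mem⁺ Fin._≟_))))
      ... | suc _ with count-pos (absent (Grown.t g)) (allFin n) (subst (0 <_) (sym eq) (s≤s z≤n))
      ... | v , _ , a = next fuel b
        where
        open Grown g using (t; once)
        iv = proj₁ (absent⁻ t a)
        v∉ = proj₂ (absent⁻ t a)
        step : ∀ {x} → x ∈ verts t → Path _~_ x v → ∃₂ λ z y → z ∈ verts t × y ∉ verts t × z ~ y × Inner y
        step x∈ record { vertices = x ∷ xs ; starts = refl ; ends = e ; linked = l ; unique = u } =
          crossing (verts t) x xs l e u x∈ v∉ iv
        next : ∀ fuel → n ≤ length (verts t) + fuel → ∃ λ g → ∀ {v} → Inner v → v ∈ verts (Grown.t g)
        next zero b = ⊥-elim (<⇒≱ (≤-trans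
          (unique-⊆-length Fin._≟_ {v ∷ verts t} {allFin n} (All.tabulate (λ i e → v∉ (subst (_∈ verts t) (sym e) i)) ∷ once) (λ _ → ∈-allFin _))
          (≤-reflexive (length-tabulate id))) (≤-trans b (≤-reflexive (+-identityʳ _))))
        next (suc fuel) b with step (root∈ t) (connected (root t) v)
        ... | z , y , z∈ , y∉ , z~y , iy with grow g z∈ y∉ z~y iy
        ... | g′ , size = go fuel g′ (≤-trans b (≤-reflexive (trans (+-suc _ fuel) (cong (_+ fuel) (sym size)))))

    record Collected (ls : List (Fin n)) : Set where
      field
        inL outL : List (Fin n × Fin n)
        perm     : map proj₁ inL ++ map proj₁ outL ↭ ls
        inOK     : ∀ {y z} → (y , z) ∈ inL → T (D y z) × Inner z
        outOK    : ∀ {y z} → (y , z) ∈ outL → T (D z y) × Inner z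

    -- The first vertex after the leaf on the path to r is r itself or is followed by a further
    -- vertex. The inner vertex r excludes the single-arc tree, where the neighbour of a leaf is a
    -- leaf.
    inner-neighbour : ∀ {v r} → T (isLeaf v) → Inner r → ∃ λ y → v ~ y × Inner y
    inner-neighbour {v} {r} lv ir with second {v} {r} (λ { refl → T-not⇒¬T ir lv })
    ... | y , v~y , inj₁ refl           = y , v~y , ir
    ... | y , v~y , inj₂ (w , y~w , w≢) = y , v~y , two-neighbours y~w (~-sym v~y) w≢

    collect : ∀ {r} → Inner r → ∀ ls → (∀ {v} → v ∈ ls → T (isLeaf v)) → Collected ls
    collect ir []       _  = record { inL = [] ; outL = [] ; perm = ↭-refl ; inOK = λ () ; outOK = λ () }
    collect ir (v ∷ ls) lf with collect ir ls (lf ∘ there) | inner-neighbour (lf (here refl)) ir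
    ... | c | y , fwd a , iy = record
      { inL = (v , y) ∷ inL ; outL = outL ; perm = prep v perm
      ; inOK = λ { (here refl) → a , iy ; (there i) → inOK i } ; outOK = outOK }
      where open Collected c
    ... | c | y , bwd a , iy = record
      { inL = inL ; outL = (v , y) ∷ outL ; perm = ↭-trans (shift v (map proj₁ inL) (map proj₁ outL)) (prep v perm)
      ; inOK = inOK ; outOK = λ { (here refl) → a , iy ; (there i) → outOK i } }
      where open Collected c

    leafCount innerCount : ℕ
    leafCount  = count isLeaf (allFin n)
    innerCount = count (not ∘ isLeaf) (allFin n)

    leaf+inner : leafCount + innerCount ≡ n
    leaf+inner = trans (go (allFin n)) (length-tabulate id)
      where
      go : ∀ xs → count isLeaf xs + count (not ∘ isLeaf) xs ≡ length xs
      go [] = refl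
      go (x ∷ xs) with isLeaf x
      ... | true  = cong suc (go xs)
      ... | false = trans (+-suc _ _) (cong suc (go xs))

    leaves-count : ∣ leaves D ∣ ≡ leafCount
    leaves-count = card-tabulate id isLeaf

    dissect : ∀ {r} → Inner r → ∃ λ (δ : Dissection D) →
              length (Dissection.inLeaves δ) + length (Dissection.outLeaves δ) ≡ leafCount ×
              length (verts (Dissection.inner δ)) ≡ innerCount
    dissect {r} ir with spanning r ir | collect ir (keep isLeaf (allFin n)) (λ i → proj₂ (∈-keep⁻ isLeaf (allFin n) i))
    ... | g , all-inner | c = record
      { inner     = t
      ; inLeaves  = inL
      ; outLeaves = outL
      ; unique    = unique-++⁺ once leaves! (λ i j → T-not⇒¬T (inner i) (is-leaf j))
      ; covers    = λ v → cover v (T? (isLeaf v))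
      ; inParent  = all-inner ∘ proj₂ ∘ inOK
      ; outParent = all-inner ∘ proj₂ ∘ outOK
      ; classify  = classify
      } , size-leaves , size-inner
      where
      open Grown g
      open Collected c
      L = map proj₁ inL ++ map proj₁ outL
      leaves! : Unique L
      leaves! = unique-↭ (↭-sym perm) (keep-unique isLeaf (Unique.allFin⁺ n))
      is-leaf : ∀ {v} → v ∈ L → T (isLeaf v)
      is-leaf i = proj₂ (∈-keep⁻ isLeaf (allFin n) (∈-resp-↭ perm i))
      leaf∈ : ∀ {v} → T (isLeaf v) → v ∈ L
      leaf∈ {v} l = ∈-resp-↭ (↭-sym perm) (∈-keep⁺ isLeaf (∈-allFin v) l)
      cover : ∀ v → Dec (T (isLeaf v)) → v ∈ verts t ++ L
      cover v (yes l) = ∈-++⁺ʳ (verts t) (leaf∈ l)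
      cover v (no ¬l) = ∈-++⁺ˡ (all-inner (¬T⇒T-not ¬l))
      split : ∀ {v} → v ∈ L → (∃ λ z → (v , z) ∈ inL) ⊎ (∃ λ z → (v , z) ∈ outL)
      split i with ∈-++⁻ (map proj₁ inL) i
      ... | inj₁ j with ∈-map⁻ proj₁ j
      ... | (_ , z) , k , refl = inj₁ (z , k)
      split i | inj₂ j with ∈-map⁻ proj₁ j
      ... | (_ , z) , k , refl = inj₂ (z , k)
      -- An arc at a leaf joins it to the neighbour recorded with it, the only one it has, and
      -- asymmetry excludes the wrong direction.
      classify : ∀ {u v} → T (D u v) → (u , v) ∈ arcs t ⊎ (u , v) ∈ inL ⊎ (v , u) ∈ outL
      classify {u} {v} a with T? (isLeaf u) | T? (isLeaf v)
      ... | no ¬lu | no ¬lv = inj₁ (hasArc (all-inner (¬T⇒T-not ¬lu)) (all-inner (¬T⇒T-not ¬lv)) a)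
      ... | yes lu | _ with split (leaf∈ lu)
      ... | inj₁ (z , k) with leaf-neighbour lu (fwd a) (fwd (proj₁ (inOK k)))
      ... | refl = inj₂ (inj₁ k)
      classify {u} {v} a | yes lu | _ | inj₂ (z , k) with leaf-neighbour lu (fwd a) (bwd (proj₁ (outOK k)))
      ... | refl = ⊥-elim (asymmetric a (proj₁ (outOK k)))
      classify {u} {v} a | no ¬lu | yes lv with split (leaf∈ lv)
      ... | inj₁ (z , k) with leaf-neighbour lv (bwd a) (fwd (proj₁ (inOK k)))
      ... | refl = ⊥-elim (asymmetric a (proj₁ (inOK k)))
      classify {u} {v} a | no ¬lu | yes lv | inj₂ (z , k) with leaf-neighbour lv (bwd a) (bwd (proj₁ (outOK k)))
      ... | refl = inj₂ (inj₂ k)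
      size-leaves : length inL + length outL ≡ leafCount
      size-leaves = begin
        length inL + length outL ≡⟨ sym (cong₂ _+_ (length-map proj₁ inL) (length-map proj₁ outL)) ⟩
        length (map proj₁ inL) + length (map proj₁ outL) ≡⟨ sym (length-++ (map proj₁ inL)) ⟩
        length L ≡⟨ ↭-length perm ⟩
        length (keep isLeaf (allFin n)) ≡⟨ length-keep isLeaf (allFin n) ⟩
        leafCount ∎
        where open ≡-Reasoning
      size-inner : length (verts t) ≡ innerCount
      size-inner = trans (≤-antisym
        (unique-⊆-length Fin._≟_ once (λ i → ∈-keep⁺ (not ∘ isLeaf) (∈-allFin _) (inner i)))
        (unique-⊆-length Fin._≟_ (keep-unique (not ∘ isLeaf) (Unique.allFin⁺ n)) (λ i → all-inner (proj₂ (∈-keep⁻ (not ∘ isLeaf) (allFin n) i)))))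
        (length-keep (not ∘ isLeaf) (allFin n))

    module Star (r : Fin n) (others : ∀ {v} → v ≢ r → T (isLeaf v)) where

      -- Two adjacent leaves would be cut off from every other vertex, and hence from r.
      centre : ∀ {u v} → u ~ v → u ≡ r ⊎ v ≡ r
      centre {u} {v} u~v with u Fin.≟ r | v Fin.≟ r
      ... | yes p | _     = inj₁ p
      ... | no _  | yes q = inj₂ q
      ... | no p  | no q with second p
      ... | y , u~y , inj₁ refl with leaf-neighbour (others p) u~v u~y
      ... | refl = inj₂ refl
      centre {u} {v} u~v | no p | no q | y , u~y , inj₂ (w , y~w , w≢u) with leaf-neighbour (others p) u~v u~y
      ... | refl with leaf-neighbour (others q) y~w (~-sym u~y)
      ... | refl = ⊥-elim (w≢u refl)

      spoke : ∀ {v} → v ≢ r → v ~ r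
      spoke {v} v≢r with second v≢r
      ... | y , v~y , _ with centre v~y
      ... | inj₁ e    = ⊥-elim (v≢r e)
      ... | inj₂ refl = v~y

  -- Stars are bi-arborescences.

  module StarTree {X : Set} (_≟_ : DecidableEquality X) (_⟶_ : Rel X 0ℓ) (asym : Asymmetric _⟶_) (ρ : X)
                  (centre : ∀ {u v} → SymClosure _⟶_ u v → u ≡ ρ ⊎ v ≡ ρ) (spoke : ∀ {v} → v ≢ ρ → SymClosure _⟶_ v ρ) where

    private
      _~_ = SymClosure _⟶_
      ~-sym = symmetric _⟶_

    edge : ∀ {u v} → u ~ v → u ≢ v → Path _~_ u v
    edge {u} {v} l u≢v = record { vertices = u ∷ v ∷ [] ; starts = refl ; ends = refl ; linked = l ∷ [-] ; unique = (u≢v ∷ []) ∷ [] ∷ [] }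

    path : ∀ u v → Path _~_ u v
    path u v with u ≟ v
    ... | yes refl = record { vertices = u ∷ [] ; starts = refl ; ends = refl ; linked = [-] ; unique = [] ∷ [] }
    ... | no u≢v with u ≟ ρ | v ≟ ρ
    ... | yes refl | _        = edge (~-sym (spoke (u≢v ∘ sym))) u≢v
    ... | no u≢ρ   | yes refl = edge (spoke u≢ρ) u≢v
    ... | no u≢ρ   | no v≢ρ   = record
      { vertices = u ∷ ρ ∷ v ∷ [] ; starts = refl ; ends = refl ; linked = spoke u≢ρ ∷ ~-sym (spoke v≢ρ) ∷ [-]
      ; unique = (u≢ρ ∷ u≢v ∷ []) ∷ ((v≢ρ ∘ sym) ∷ []) ∷ [] ∷ [] }

    -- Three consecutive edges of a cycle have no common vertex, yet each of them contains `ρ`.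
    acyclic : ¬ Cycle _~_
    acyclic record { rest = _ ∷ [] ; long = s≤s () }
    acyclic record { rest = b ∷ c ∷ [] ; linked = ab ∷ bc ∷ ca ∷ [-] ; unique = (a≢b ∷ a≢c ∷ []) ∷ (b≢c ∷ []) ∷ _ }
      with centre ab | centre bc | centre ca
    ... | inj₁ refl | inj₁ refl | _         = a≢b refl
    ... | inj₁ refl | inj₂ refl | _         = a≢c refl
    ... | inj₂ refl | _         | inj₁ refl = b≢c refl
    ... | inj₂ refl | _         | inj₂ refl = a≢b refl
    acyclic record { rest = b ∷ c ∷ d ∷ _ ; linked = ab ∷ bc ∷ cd ∷ _ ; unique = (a≢b ∷ a≢c ∷ a≢d ∷ _) ∷ (b≢c ∷ b≢d ∷ _) ∷ _ }
      with centre ab | centre bc | centre cd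
    ... | inj₁ refl | inj₁ refl | _         = a≢b refl
    ... | inj₁ refl | inj₂ refl | _         = a≢c refl
    ... | inj₂ refl | _         | inj₁ refl = b≢c refl
    ... | inj₂ refl | _         | inj₂ refl = b≢d refl

    isOrientedTree : IsOrientedTree _⟶_
    isOrientedTree = record { inhabited = ρ ; asymmetric = asym ; connected = path ; acyclic = acyclic }

    irrefl : ∀ {u v} → u ⟶ v → u ≢ v
    irrefl a refl = asym a a

    inArborescence : (∀ {u v} → u ⟶ v → v ≡ ρ) → IsInArborescence _⟶_ ρ
    inArborescence into = record { isOrientedTree = isOrientedTree ; towards = towards }
      where
      towards : ∀ {u v} → u ⟶ v → OnPath _⟶_ ρ v u
      towards a with refl ← into a = edge (bwd a) (irrefl a ∘ sym) , here refl

    outArborescence : (∀ {u v} → u ⟶ v → u ≡ ρ) → IsOutArborescence _⟶_ ρ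
    outArborescence from = record { isOrientedTree = isOrientedTree ; away = away }
      where
      away : ∀ {u v} → u ⟶ v → OnPath _⟶_ ρ u v
      away a with refl ← from a = edge (fwd a) (irrefl a) , here refl

  module _ {n : ℕ} (p : Fin n → Bool) where

    ∈-tabulate⁺ : ∀ {v} → T (p v) → v Subset.∈ Vec.tabulate p
    ∈-tabulate⁺ {v} t = lookup⇒[]= v (Vec.tabulate p) (trans (lookup∘tabulate p v) (Equivalence.to T-≡ t))

    ∈-tabulate⁻ : ∀ {v} → v Subset.∈ Vec.tabulate p → T (p v)
    ∈-tabulate⁻ {v} i = Equivalence.from T-≡ (trans (sym (lookup∘tabulate p v)) ([]=⇒lookup i))

  module _ {n : ℕ} {S : Subset.Subset n} where

    vertex-≡ : ∀ {u v : ∃ λ x → x Subset.∈ S} → proj₁ u ≡ proj₁ v → u ≡ v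
    vertex-≡ {u , i} {_ , j} refl = cong (u ,_) ([]=-irrelevant i j)

    vertex-≟ : DecidableEquality (∃ λ x → x Subset.∈ S)
    vertex-≟ u v with proj₁ u Fin.≟ proj₁ v
    ... | yes e = yes (vertex-≡ e)
    ... | no ne = no (ne ∘ cong proj₁)

  -- The arcs into r form the in-part and the arcs out of r the out-part. Every arc meets r by
  -- `centre`, and asymmetry prevents a vertex other than r from lying in both parts.
  star-biarborescence : ∀ {n} (D : Digraph n) (tree : IsOrientedTree (Arc D)) (r : Fin n) →
                        (∀ {v} → v ≢ r → T (Tree.isLeaf D tree v)) → IsBiArborescence D
  star-biarborescence {n} D tree r others = r , record
    { isOrientedTree  = tree
    ; inPart          = inPart
    ; outPart         = outPart
    ; root∈in         = root-in
    ; root∈out        = root-out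
    ; inArborescence  = StarTree.inArborescence vertex-≟ (Part.PartArc inPart) (λ {u} {v} → asym-in {u} {v}) (r , root-in)
        (λ e → [ (λ a → inj₂ (vertex-≡ (at-r⁻ (proj₁ (∧⁻ a))))) , (λ a → inj₁ (vertex-≡ (at-r⁻ (proj₁ (∧⁻ a))))) ]′ (un e))
        (λ {v} v≢ → fwd (∧⁺ (at-r⁺ refl) ([ (λ e → ⊥-elim (v≢ (vertex-≡ (at-r⁻ e)))) , id ]′ (∨⁻ (∈-tabulate⁻ inV (proj₂ v))))))
        (λ a → vertex-≡ (at-r⁻ (proj₁ (∧⁻ a))))
    ; outArborescence = StarTree.outArborescence vertex-≟ (Part.PartArc outPart) (λ {u} {v} → asym-out {u} {v}) (r , root-out)
        (λ e → [ (λ a → inj₁ (vertex-≡ (at-r⁻ (proj₁ (∧⁻ a))))) , (λ a → inj₂ (vertex-≡ (at-r⁻ (proj₁ (∧⁻ a))))) ]′ (un e))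
        (λ {v} v≢ → bwd (∧⁺ (at-r⁺ refl) ([ (λ e → ⊥-elim (v≢ (vertex-≡ (at-r⁻ e)))) , id ]′ (∨⁻ (∈-tabulate⁻ outV (proj₂ v))))))
        (λ a → vertex-≡ (at-r⁻ (proj₁ (∧⁻ a))))
    ; meet            = λ i j → meet (∨⁻ (∈-tabulate⁻ inV i)) (∨⁻ (∈-tabulate⁻ outV j))
    ; vertsUnion      = ⊆-antisym ⊆⊤ (λ {v} _ → x∈p∪q⁺ (union v (v Fin.≟ r)))
    ; arcsUnion       = arcsUnion
    }
    where
    open IsOrientedTree tree
    open Tree.Star D tree r others
    at-r : Fin n → Bool
    at-r v = does (v Fin.≟ r)
    at-r⁺ : ∀ {v} → v ≡ r → T (at-r v)
    at-r⁺ {v} e with v Fin.≟ r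
    ... | yes _ = _
    ... | no ne = ne e
    at-r⁻ : ∀ {v} → T (at-r v) → v ≡ r
    at-r⁻ {v} t with v Fin.≟ r
    ... | yes e = e
    ∧⁻ : ∀ {a b} → T (a ∧ b) → T a × T b
    ∧⁻ = Equivalence.to T-∧
    ∧⁺ : ∀ {a b} → T a → T b → T (a ∧ b)
    ∧⁺ s t = Equivalence.from T-∧ (s , t)
    ∨⁻ : ∀ {a b} → T (a ∨ b) → T a ⊎ T b
    ∨⁻ = Equivalence.to T-∨
    ∨⁺ : ∀ {a b} → T a ⊎ T b → T (a ∨ b)
    ∨⁺ = Equivalence.from T-∨
    un : ∀ {A : Set} {R : Rel A 0ℓ} {u v} → SymClosure R u v → R u v ⊎ R v u
    un (fwd a) = inj₁ a
    un (bwd a) = inj₂ a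
    inV outV : Fin n → Bool
    inV  v = at-r v ∨ D v r
    outV v = at-r v ∨ D r v
    inPart outPart : Part
    inPart = record { verts = Vec.tabulate inV ; arcs = λ u v → at-r v ∧ D u v
                    ; ends = λ a → let e , b = ∧⁻ a in ∈-tabulate⁺ inV (∨⁺ (inj₂ (subst (T ∘ D _) (at-r⁻ e) b))) , ∈-tabulate⁺ inV (∨⁺ (inj₁ e)) }
    outPart = record { verts = Vec.tabulate outV ; arcs = λ u v → at-r u ∧ D u v
                     ; ends = λ a → let e , b = ∧⁻ a in ∈-tabulate⁺ outV (∨⁺ (inj₁ e)) , ∈-tabulate⁺ outV (∨⁺ (inj₂ (subst (λ u → T (D u _)) (at-r⁻ e) b))) }
    root-in : r Subset.∈ Part.verts inPart
    root-in = ∈-tabulate⁺ inV (∨⁺ (inj₁ (at-r⁺ refl)))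
    root-out : r Subset.∈ Part.verts outPart
    root-out = ∈-tabulate⁺ outV (∨⁺ (inj₁ (at-r⁺ refl)))
    asym-in : Asymmetric (Part.PartArc inPart)
    asym-in a b = asymmetric (proj₂ (∧⁻ a)) (proj₂ (∧⁻ b))
    asym-out : Asymmetric (Part.PartArc outPart)
    asym-out a b = asymmetric (proj₂ (∧⁻ a)) (proj₂ (∧⁻ b))
    meet : ∀ {v} → T (at-r v) ⊎ T (D v r) → T (at-r v) ⊎ T (D r v) → v ≡ r
    meet (inj₁ e) _        = at-r⁻ e
    meet (inj₂ _) (inj₁ e) = at-r⁻ e
    meet (inj₂ a) (inj₂ b) = ⊥-elim (asymmetric a b)
    union : ∀ v → Dec (v ≡ r) → v Subset.∈ Part.verts inPart ⊎ v Subset.∈ Part.verts outPart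
    union v (yes e) = inj₁ (∈-tabulate⁺ inV (∨⁺ (inj₁ (at-r⁺ e))))
    union v (no ne) with spoke ne
    ... | fwd a = inj₁ (∈-tabulate⁺ inV (∨⁺ (inj₂ a)))
    ... | bwd a = inj₂ (∈-tabulate⁺ outV (∨⁺ (inj₂ a)))
    arcsUnion : ∀ u v → D u v ≡ (at-r v ∧ D u v) ∨ (at-r u ∧ D u v)
    arcsUnion u v with D u v in eq
    ... | false = absorb (at-r v) (at-r u)
      where
      absorb : ∀ a b → false ≡ (a ∧ false) ∨ (b ∧ false)
      absorb true  true  = refl
      absorb true  false = refl
      absorb false true  = refl
      absorb false false = refl
    ... | true with centre (fwd (subst T (sym eq) _))
    ... | inj₁ e = sym (Equivalence.to T-≡ (∨⁺ {at-r v ∧ true} (inj₂ (∧⁺ (at-r⁺ e) _))))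
    ... | inj₂ e = sym (Equivalence.to T-≡ (∨⁺ {at-r v ∧ true} (inj₁ (∧⁺ (at-r⁺ e) _))))

  -- Deciding unavoidability and finding the least order.

  Searchable : Set → Set₁
  Searchable A = ∀ {P : A → Set} → (∀ a → Dec (P a)) → Dec (∃ P)

  bool-searchable : Searchable Bool
  bool-searchable P? with P? true | P? false
  ... | yes p | _     = yes (true , p)
  ... | no _  | yes p = yes (false , p)
  ... | no ¬p | no ¬q = no λ { (true , p) → ¬p p ; (false , q) → ¬q q }

  vec-searchable : ∀ {A} → Searchable A → ∀ n → Searchable (Vec A n)
  vec-searchable s zero    P? = map′ (λ p → [] , p) (λ { ([] , p) → p }) (P? [])
  vec-searchable s (suc n) P? = map′ (λ { (a , v , p) → a ∷ v , p }) (λ { (a ∷ v , p) → a , v , p })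
    (s (λ a → vec-searchable s n (P? ∘ (a ∷_))))

  copy? : ∀ {n m} (D : Digraph n) (T : Digraph m) → Dec (Copy D T)
  copy? {n} {m} D T′ = map′ to from (vec-searchable Fin.any? n λ xs →
      (Fin.all? λ u → Fin.all? λ v → (Vec.lookup xs u Fin.≟ Vec.lookup xs v) →-dec (u Fin.≟ v)) ×-dec
      (Fin.all? λ u → Fin.all? λ v → T? (D u v) →-dec T? (T′ (Vec.lookup xs u) (Vec.lookup xs v))))
    where
    Good : Vec (Fin m) n → Set
    Good xs = (∀ u v → Vec.lookup xs u ≡ Vec.lookup xs v → u ≡ v) × (∀ u v → T (D u v) → T (T′ (Vec.lookup xs u) (Vec.lookup xs v)))
    to : ∃ Good → Copy D T′
    to (xs , inj , hom) = record { embed = Vec.lookup xs ; injective = inj _ _ ; preserves = hom _ _ }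
    from : Copy D T′ → ∃ Good
    from c = Vec.tabulate embed
      , (λ u v e → injective (trans (sym (lookup∘tabulate embed u)) (trans e (lookup∘tabulate embed v))))
      , (λ u v a → subst₂ (λ x y → T (T′ x y)) (sym (lookup∘tabulate embed u)) (sym (lookup∘tabulate embed v)) (preserves a))
      where open Copy c

  tournament? : ∀ {m} (T : Digraph m) → Dec (IsTournament (Arc T))
  tournament? D = map′ (λ (a , c) → record { asymmetric = a _ _ ; complete = λ {u} {v} n → from (c u v n) })
                       (λ t → (λ _ _ → IsTournament.asymmetric t) , λ u v n → to (IsTournament.complete t n))
    ((Fin.all? λ u → Fin.all? λ v → T? (D u v) →-dec ¬? (T? (D v u))) ×-dec
     (Fin.all? λ u → Fin.all? λ v → ¬? (u Fin.≟ v) →-dec (T? (D u v) ⊎-dec T? (D v u))))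
    where
    from : ∀ {u v} → T (D u v) ⊎ T (D v u) → SymClosure (Arc D) u v
    from (inj₁ a) = fwd a
    from (inj₂ a) = bwd a
    to : ∀ {u v} → SymClosure (Arc D) u v → T (D u v) ⊎ T (D v u)
    to (fwd a) = inj₁ a
    to (bwd a) = inj₂ a

  -- Exhaustive search for a tournament without a copy, among matrices of Booleans. An arbitrary
  -- tournament agrees entry by entry with its matrix, and copies are carried over along this
  -- agreement.
  unavoidable? : ∀ {n} (D : Digraph n) m → Dec (Unavoidable D m)
  unavoidable? D m with vec-searchable (vec-searchable bool-searchable m) m
                          (λ t → tournament? (digraph t) ×-dec ¬? (copy? D (digraph t)))
    where
    digraph : Vec (Vec Bool m) m → Digraph m
    digraph t u v = Vec.lookup (Vec.lookup t u) v
  ... | yes (t , isT , none) = no λ un → none (un _ isT)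
  ... | no  avoided = yes λ T′ isT → decidable-stable (copy? D T′) λ none →
      let T″ = λ u v → Vec.lookup (Vec.lookup (Vec.tabulate (Vec.tabulate ∘ T′)) u) v
          same : ∀ u v → T″ u v ≡ T′ u v
          same u v = trans (cong (λ r → Vec.lookup r v) (lookup∘tabulate (Vec.tabulate ∘ T′) u)) (lookup∘tabulate (T′ u) v)
      in avoided (Vec.tabulate (Vec.tabulate ∘ T′)
         , record { asymmetric = λ {u} {v} a b → IsTournament.asymmetric isT (subst T (same u v) a) (subst T (same v u) b)
                  ; complete   = λ {u} {v} n → transport T″ same (IsTournament.complete isT n) }
         , λ c → none (record { embed = Copy.embed c ; injective = Copy.injective c ; preserves = λ a → subst T (same _ _) (Copy.preserves c a) }))
    where
    transport : ∀ {T′} T″ → (∀ u v → T″ u v ≡ T′ u v) → ∀ {u v} → SymClosure (Arc T′) u v → SymClosure (Arc T″) u v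
    transport T″ same (fwd a) = fwd (subst T (sym (same _ _)) a)
    transport T″ same (bwd a) = bwd (subst T (sym (same _ _)) a)

  -- Searches upwards from 0, with the distance to `M` as fuel. It turns an upper bound into the
  -- existence of the least order, together with the comparison.
  least : ∀ {P : ℕ → Set} → (∀ m → Dec (P m)) → ∀ {M} → P M → ∃ λ u → P u × (∀ {m} → P m → u ≤ m) × u ≤ M
  least {P} P? {M} pM = go M 0 (λ _ ()) (+-identityʳ M)
    where
    go : ∀ fuel u → (∀ m → m < u → ¬ P m) → fuel + u ≡ M → ∃ λ u → P u × (∀ {m} → P m → u ≤ m) × u ≤ M
    go fuel u below e with P? u
    ... | yes p = u , p , (λ {m} pm → ≮⇒≥ (λ m<u → below m m<u pm)) , ≤-trans (m≤n+m u fuel) (≤-reflexive e)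
    go zero u below refl | no ¬p = contradiction pM ¬p
    go (suc fuel) u below e | no ¬p = go fuel (suc u) below′ (trans (+-suc fuel u) e)
      where
      below′ : ∀ m → m < suc u → ¬ P m
      below′ m (s≤s m≤u) with m≤n⇒m<n∨m≡n m≤u
      ... | inj₁ m<u  = below m m<u
      ... | inj₂ refl = ¬p

  unvd≤ : ∀ {n} (D : Digraph n) {M} → Unavoidable D M → ∃ λ u → IsUnvd D u × u ≤ M
  unvd≤ D un with least (unavoidable? D) un
  ... | u , unavoidable , minimal , u≤M = u , record { unavoidable = unavoidable ; least = minimal } , u≤M

  -- The upper bound for trees that are not bi-arborescences.

  module _ {n : ℕ} (D : Digraph n) (tree : IsOrientedTree (Arc D)) where

    open Tree D tree
    open Dissection

    -- With at most one inner vertex the tree is a star, centred at that vertex or, if there is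
    -- none, at any vertex.
    two-inner : ¬ IsBiArborescence D → 2 ≤ innerCount
    two-inner notBi with 2 ≤? innerCount
    ... | yes two = two
    ... | no  few with count-pos (not ∘ isLeaf) (allFin n) ∘ n≢0⇒n>0 | innerCount ≟ 0
    ... | _ | yes none = ⊥-elim (notBi (star-biarborescence D tree (IsOrientedTree.inhabited tree) λ {v} _ →
            ¬inner⇒leaf (λ iv → <⇒≱ (inner-one v iv) (≤-reflexive none))))
      where
      inner-one : ∀ v → Inner v → 0 < innerCount
      inner-one v iv = ≤-trans (unique-⊆-length Fin._≟_ {v ∷ []} {keep (not ∘ isLeaf) (allFin n)} ([] ∷ [])
        λ { (here refl) → ∈-keep⁺ (not ∘ isLeaf) (∈-allFin v) iv }) (≤-reflexive (length-keep (not ∘ isLeaf) (allFin n)))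
    ... | some | no one with some one
    ... | r , _ , ir = ⊥-elim (notBi (star-biarborescence D tree r λ {v} v≢r → ¬inner⇒leaf (λ iv → few (inner-two v≢r iv))))
      where
      inner-two : ∀ {v} → v ≢ r → Inner v → 2 ≤ innerCount
      inner-two {v} v≢r iv = ≤-trans (unique-⊆-length Fin._≟_ {v ∷ r ∷ []} {keep (not ∘ isLeaf) (allFin n)} ((v≢r ∷ []) ∷ [] ∷ [])
        λ { (here refl) → ∈-keep⁺ (not ∘ isLeaf) (∈-allFin v) iv ; (there (here refl)) → ∈-keep⁺ (not ∘ isLeaf) (∈-allFin r) ir })
        (≤-reflexive (length-keep (not ∘ isLeaf) (allFin n)))

    -- Here 1 + d is the number of arcs between inner vertices.
    unavoidable : ∀ {d} → innerCount ≡ suc (suc d) → Unavoidable D (2 * leafCount + 4 * suc d)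
    unavoidable {d} inner≡ T′ isT with count-pos (not ∘ isLeaf) (allFin n) (subst (0 <_) (sym inner≡) (s≤s z≤n))
    ... | r , _ , ir with dissect ir
    ... | δ , leaves≡ , verts≡ = copy (contains-tree complete δ (≤-trans (s≤s z≤n) (≤-reflexive (sym edges≡))) size)
      where
      m = 2 * leafCount + 4 * suc d
      open Host {Fin n} {Fin m} Fin._≟_ Fin._≟_ (allFin m) (Unique.allFin⁺ m) ∈-allFin
      complete : ∀ {x y} → x ≢ y → T (T′ x y) ⊎ T (T′ y x)
      complete x≢y with IsTournament.complete isT x≢y
      ... | fwd a = inj₁ a
      ... | bwd a = inj₂ a
      edges≡ : edges (inner δ) ≡ suc d
      edges≡ = suc-injective (trans (sym (length-verts (inner δ))) (trans verts≡ inner≡))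
      size : length (allFin m) ≡ 2 * (length (inLeaves δ) + length (outLeaves δ)) + 4 * edges (inner δ)
      size = trans (length-tabulate {n = m} id) (sym (cong₂ (λ x y → 2 * x + 4 * y) leaves≡ edges≡))
      copy : Contains T′ D → Copy D T′
      copy (φ , inj , hom) = record { embed = φ ; injective = inj ; preserves = hom }

-- Comparison with the rounded rational bound.

open import Data.Nat using (ℕ; suc)
open import Data.Integer using (ℤ; +_; _*_; _-_; _≤_)
open import Data.Rational as ℚ using (_/_; ceiling)
open import Data.Fin.Subset using (∣_∣)
open import Data.Product using (_×_; ∃-syntax)
open import Relation.Binary.PropositionalEquality using (_≡_)
open import Relation.Nullary using (¬_)
open import Data.Integer as ℤ using (-_; -[1+_]; _+_; _<_; +≤+; +<+)
import Data.Integer.Properties as ℤ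
import Data.Integer.DivMod as ℤ using ([n/d]*d≤n)
open import Data.Integer.Solver using (module +-*-Solver)
import Data.Nat as ℕ
import Data.Nat.Properties as ℕ
open import Data.Product using (_,_)
open import Data.Rational using (ℚ; mkℚ; toℚᵘ)
import Data.Rational.Properties as ℚ
open import Data.Rational.Unnormalised as ℚᵘ using (ℚᵘ; mkℚᵘ)
import Data.Rational.Unnormalised.Properties as ℚᵘ
open import Relation.Binary.PropositionalEquality using (refl; sym; trans; cong; cong₂; subst)
open +-*-Solver using (solve; _:+_; _:*_; _:-_; :-_; _:=_; con)

-- As the ceiling of x is minus the floor of -x, it suffices that this floor lies strictly below -i,
-- which is checked after multiplying by the denominator.
<ceiling : ∀ i x → i / 1 ℚ.< x → i < ceiling x
<ceiling i x@(mkℚ a d _) i<x = ℤ.neg-cancel-< (ℤ.≤-<-trans (ℤ.≤-reflexive (ℤ.neg-involutive q)) (ℤ.*-cancelʳ-<-nonNeg (+ suc d) q<))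
  where
  q = ℚ.floor (ℚ.- x)
  i<x′ : mkℚᵘ i 0 ℚᵘ.< toℚᵘ x
  i<x′ = ℚᵘ.<-respˡ-≃ (ℚ.toℚᵘ-fromℚᵘ (mkℚᵘ i 0)) (ℚ.toℚᵘ-mono-< i<x)
  scaled : i * + suc d < a
  scaled = subst (i * + suc d <_) (ℤ.*-identityʳ a) (ℚᵘ.drop-*<* i<x′)
  q< : q * + suc d < (- i) * + suc d
  q< = ℤ.≤-<-trans (floor≤ x) (subst (- a <_) (ℤ.neg-distribˡ-* i (+ suc d)) (ℤ.neg-mono-< scaled))
    where
    -- Split by the sign of the numerator, because the negation of a rational computes only then.
    floor≤ : ∀ y → ℚ.floor (ℚ.- y) * ℚ.↧ y ≤ - (ℚ.↥ y)
    floor≤ (mkℚ (+ 0)       e _) = ℤ.[n/d]*d≤n (+ 0) (+ suc e)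
    floor≤ (mkℚ (+ suc m)   e _) = ℤ.[n/d]*d≤n (-[1+ m ]) (+ suc e)
    floor≤ (mkℚ (-[1+ m ])  e _) = ℤ.[n/d]*d≤n (+ suc m) (+ suc e)

bound : ℕ → ℕ → ℤ
bound n k = + 4 * + n - + 2 * + k - + 4

threshold : ℕ → ℕ → ℚ
threshold n k = (+ 9 / 2) ℚ.* (+ n / 1) ℚ.- (+ 5 / 2) ℚ.* (+ k / 1) ℚ.- (+ 9 / 2)

order-split : ∀ k d → + (k ℕ.+ suc (suc d)) ≡ + k + (+ 2 + + d)
order-split k d = trans (ℤ.pos-+ k (suc (suc d))) (cong (λ z → + k + z) (ℤ.pos-+ 2 d))

-- Writing n as k plus the number 2 + d of inner vertices leaves no subtraction, so the integer
-- bound becomes the natural number used in the embedding.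
bound≡ : ∀ k d → bound (k ℕ.+ suc (suc d)) k ≡ + (2 ℕ.* k ℕ.+ 4 ℕ.* suc d)
bound≡ k d = trans (cong (λ m → + 4 * m - + 2 * + k - + 4) (order-split k d)) (trans
  (solve 2 (λ k d → con (+ 4) :* (k :+ (con (+ 2) :+ d)) :- con (+ 2) :* k :- con (+ 4) := con (+ 2) :* k :+ con (+ 4) :* (con (+ 1) :+ d)) refl (+ k) (+ d))
  (sym (trans (ℤ.pos-+ (2 ℕ.* k) (4 ℕ.* suc d))
    (cong₂ _+_ (ℤ.pos-* 2 k) (trans (ℤ.pos-* 4 (suc d)) (cong (λ z → + 4 * z) (ℤ.pos-+ 1 d)))))))

-- The difference of the two sides is (n - k - 1)/2 = (d + 1)/2, which is positive. The unreduced
-- fraction `y` has denominator 8, whence the integer gap 4d + 4.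
bound<threshold : ∀ k d → bound (k ℕ.+ suc (suc d)) k / 1 ℚ.< threshold (k ℕ.+ suc (suc d)) k
bound<threshold k d = ℚ.toℚᵘ-cancel-< (ℚᵘ.<-respˡ-≃ (ℚᵘ.≃-sym (ℚ.toℚᵘ-fromℚᵘ (mkℚᵘ (bound n k) 0))) (ℚᵘ.<-respʳ-≃ (ℚᵘ.≃-sym value) (ℚᵘ.*<* unnormalised)))
  where
  n = k ℕ.+ suc (suc d)
  N K 9/2 5/2 y : ℚᵘ
  N = mkℚᵘ (+ n) 0
  K = mkℚᵘ (+ k) 0
  9/2 = mkℚᵘ (+ 9) 1
  5/2 = mkℚᵘ (+ 5) 1
  y = 9/2 ℚᵘ.* N ℚᵘ.- 5/2 ℚᵘ.* K ℚᵘ.- 9/2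
  difference : ∀ p q → toℚᵘ (p ℚ.- q) ℚᵘ.≃ toℚᵘ p ℚᵘ.- toℚᵘ q
  difference p q = ℚᵘ.≃-trans (ℚ.toℚᵘ-homo-+ p (ℚ.- q)) (ℚᵘ.+-congʳ (toℚᵘ p) (ℚ.toℚᵘ-homo‿- q))
  minus-cong : ∀ {p p′ q q′} → p ℚᵘ.≃ p′ → q ℚᵘ.≃ q′ → p ℚᵘ.- q ℚᵘ.≃ p′ ℚᵘ.- q′
  minus-cong e f = ℚᵘ.+-cong e (ℚᵘ.-‿cong f)
  product : ∀ p m → toℚᵘ (p ℚ.* (+ m / 1)) ℚᵘ.≃ toℚᵘ p ℚᵘ.* mkℚᵘ (+ m) 0
  product p m = ℚᵘ.≃-trans (ℚ.toℚᵘ-homo-* p (+ m / 1)) (ℚᵘ.*-congˡ {toℚᵘ p} (ℚ.toℚᵘ-fromℚᵘ (mkℚᵘ (+ m) 0)))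
  value : toℚᵘ (threshold n k) ℚᵘ.≃ y
  value = ℚᵘ.≃-trans (difference ((+ 9 / 2) ℚ.* (+ n / 1) ℚ.- (+ 5 / 2) ℚ.* (+ k / 1)) (+ 9 / 2))
    (minus-cong (ℚᵘ.≃-trans (difference ((+ 9 / 2) ℚ.* (+ n / 1)) ((+ 5 / 2) ℚ.* (+ k / 1)))
      (minus-cong (product (+ 9 / 2) n) (product (+ 5 / 2) k))) ℚᵘ.≃-refl)
  lower upper : ℤ → ℤ
  lower m = (+ 4 * m - + 2 * + k - + 4) * + 8
  -- The numerator of `y` as the unnormalised operations produce it, so that the comparison holds by
  -- computation after rewriting n.
  upper m = ((+ 9 * m * + 2 + - (+ 5 * + k) * + 2) * + 2 + - + 9 * + 4) * + 1
  m = + k + (+ 2 + + d)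
  gap : upper m ≡ lower m + (+ 4 * + d + + 4)
  gap = solve 2 (λ k d → ((con (+ 9) :* (k :+ (con (+ 2) :+ d)) :* con (+ 2) :+ :- (con (+ 5) :* k) :* con (+ 2)) :* con (+ 2) :+ :- con (+ 9) :* con (+ 4)) :* con (+ 1)
      := (con (+ 4) :* (k :+ (con (+ 2) :+ d)) :- con (+ 2) :* k :- con (+ 4)) :* con (+ 8) :+ (con (+ 4) :* d :+ con (+ 4))) refl (+ k) (+ d)
  gap>0 : + 0 < + 4 * + d + + 4
  gap>0 = subst (+ 0 <_) (trans (ℤ.pos-+ (4 ℕ.* d) 4) (cong (λ z → z + + 4) (ℤ.pos-* 4 d))) (+<+ (ℕ.≤-trans (ℕ.s≤s ℕ.z≤n) (ℕ.m≤n+m 4 (4 ℕ.* d))))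
  unnormalised : bound n k * ℚᵘ.↧ y < ℚᵘ.↥ y * + 1
  unnormalised = subst (λ m → lower m < upper m) (sym (order-split k d)) (subst (lower m <_) (sym gap)
    (subst (_< lower m + (+ 4 * + d + + 4)) (ℤ.+-identityʳ (lower m)) (ℤ.+-monoʳ-< (lower m) gap>0)))

<⇒≤-1 : ∀ {i j} → i < j → i ≤ j - + 1
<⇒≤-1 {i} {j} i<j = ℤ.≤-trans (ℤ.i<j⇒i≤pred[j] i<j) (ℤ.≤-reflexive (ℤ.+-comm (- + 1) j))

bound≤ceiling : ∀ k d → bound (k ℕ.+ suc (suc d)) k ≤ ceiling (threshold (k ℕ.+ suc (suc d)) k) - + 1
bound≤ceiling k d = <⇒≤-1 (<ceiling (bound n k) (threshold n k) (bound<threshold k d))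
  where n = k ℕ.+ suc (suc d)

corollary13 : (n k : ℕ) (A : Digraph n) →
    IsOrientedTree (Arc A) →
    ∣ leaves A ∣ ≡ k →
    ¬ IsBiArborescence A →
    (∃[ u ] IsUnvd A u × + u ≤ + 4 * + n - + 2 * + k - + 4) ×
    + 4 * + n - + 2 * + k - + 4 ≤
      ceiling ((+ 9 / 2) ℚ.* (+ n / 1) ℚ.- (+ 5 / 2) ℚ.* (+ k / 1) ℚ.- (+ 9 / 2)) - + 1
corollary13 n k A tree leaves≡k notBi =
  let u , isUnvd , u≤ = Combinatorics.unvd≤ A (Combinatorics.unavoidable A tree inner≡) in
  (u , isUnvd , ℤ.≤-trans (+≤+ u≤) (ℤ.≤-reflexive (sym bound≡′))) ,
  subst (λ m → bound m k ≤ ceiling (threshold m k) - + 1) (sym n≡) (bound≤ceiling k d)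
  where
  open Combinatorics.Tree A tree
  d : ℕ
  -- The subtraction does not truncate, by `two-inner`.
  d = innerCount ℕ.∸ 2
  inner≡ : innerCount ≡ suc (suc d)
  inner≡ = sym (ℕ.m+[n∸m]≡n (Combinatorics.two-inner A tree notBi))
  leafCount≡k : leafCount ≡ k
  leafCount≡k = trans (sym leaves-count) leaves≡k
  n≡ : n ≡ k ℕ.+ suc (suc d)
  n≡ = trans (sym leaf+inner) (cong₂ ℕ._+_ leafCount≡k inner≡)
  bound≡′ : bound n k ≡ + (2 ℕ.* leafCount ℕ.+ 4 ℕ.* suc d)
  bound≡′ = trans (cong (λ m → bound m k) n≡)
    (trans (bound≡ k d) (cong (λ l → + (2 ℕ.* l ℕ.+ 4 ℕ.* suc d)) (sym leafCount≡k)))
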